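{- Let $R$ be a Dedekind domain with field of fractions $K$, let $\mathfrak{m}$ be a nonzero prime (hence maximal) ideal of $R$, and let $\widehat{K}_{\mathfrak{m}}$ be the completion of $K$ with respect to the $\mathfrak{m}$-adic valuation $v_{\mathfrak m}$, endowed with the valuation $\widehat{v_{\mathfrak m}} : \widehat{K}_{\mathfrak m}\to \mathbb{Z}_{\mathrm{m}0}$ extending $v_{\mathfrak m}$ by continuity. Then $\widehat{v_{\mathfrak m}}$ is discrete, and its unit ball $\{x\in\widehat{K}_{\mathfrak m} : \widehat{v_{\mathfrak m}}(x)\le 1\}$ is a discrete valuation ring.
   Context: $\mathbb{Z}_{\mathrm{m}0}$ is the linearly ordered commutative group with zero obtained from the multiplicatively written ordered group $\mathbb{Z}$ (elements $\mathrm{of\_add}(n)$, $n\in\mathbb{Z}$, with $\mathrm{of\_add}(a+b)=\mathrm{of\_add}(a)\,\mathrm{of\_add}(b)$, ordered as $\mathbb{Z}$) by adjoining an absorbing smallest element $0$. A valuation on a commutative unitary ring $A$ is a function $v: A\to \mathbb{Z}_{\mathrm{m}0}$ with $v(0)=0$, $v(1)=1$, $v(xy)=v(x)v(y)$ and $v(x+y)\le\max\{v(x),v(y)\}$ for all $x,y$. It is called discrete if it is surjective onto $\mathbb{Z}_{\mathrm{m}0}$. The $\mathfrak{m}$-adic valuation on $K$ is given by $v_{\mathfrak m}(0)=0$ and $v_{\mathfrak m}(r/s)=\mathrm{of\_add}(-(a(r)-a(s)))$ for nonzero $r,s\in R$, where $a(r)$ is the exponent of $\mathfrak{m}$ in the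 factorization of $(r)$ into maximal ideals. A valuation $v$ on $K$ induces a uniform structure, for which the sets $\{x : v(x)\le\gamma\}$, $\gamma\ne 0$ in $\mathbb{Z}_{\mathrm{m}0}$, form a basis of neighborhoods of $0$; the completion is the completion of this uniform space, which is again a field, and $v$ extends uniquely by continuity to a valuation on it. A discrete valuation ring is a local principal ideal domain that is not a field. -}

module Defs where

open import Algebra.Bundles using (CommutativeRing; RawRing; Semiring)
open import Algebra.Morphism.Structures using (IsRingMonomorphism)
open import Axiom.ExcludedMiddle using (ExcludedMiddle)
open import Data.Empty using (⊥-elim)
open import Data.Fin.Base using (Fin; toℕ)
open import Data.Integer.Base as ℤ using (ℤ; 0ℤ; +_)
import Data.Integer.Properties as ℤ
open import Data.List.Base using (List; []; _∷_; length; filter; foldr)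
open import Data.List.Membership.Propositional using (_∈_)
open import Data.List.Relation.Unary.All using (All)
open import Data.Nat.Base as ℕ using (ℕ)
import Data.Nat.Properties as ℕ
open import Data.Product.Base using (Σ; Σ-syntax; ∃; ∃-syntax; _×_; _,_; proj₁; proj₂)
open import Data.Sum.Base using (_⊎_; inj₁; inj₂; [_,_]′)
open import Function.Definitions using (Surjective)
open import Level using (Level; Lift; Setω; 0ℓ; _⊔_; suc)
open import Relation.Binary.Bundles using (TotalOrder)
open import Relation.Binary.PropositionalEquality
  using (_≡_; refl; sym; trans; cong; cong₂; subst; subst₂)
open import Relation.Nullary using (¬_; Dec; yes; no)
open import Relation.Nullary.Construct.Add.Infimum using (_₋; ⊥₋; [_])
import Relation.Binary.Construct.Add.Infimum.NonStrict ℤ._≤_ as Inf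
open import Relation.Unary using (Pred; _≐_; _⊆_)

-- Classical logic, taken as an explicit hypothesis wherever it is needed.  As
-- `Dec P` carries a proof of `P` for an arbitrary type `P`, this also gives
-- choice.
Classical : Setω
Classical = ∀ {a} → ExcludedMiddle a

record IsField {c ℓ} (A : CommutativeRing c ℓ) : Set (c ⊔ ℓ) where
  open CommutativeRing A
  field
    1≉0     : ¬ 1# ≈ 0#
    inverse : ∀ x → ¬ x ≈ 0# → ∃[ y ] x * y ≈ 1#

record Field c ℓ : Set (suc (c ⊔ ℓ)) where
  field
    commutativeRing : CommutativeRing c ℓ
    isField         : IsField commutativeRing
  open CommutativeRing commutativeRing public
  open IsField isField public

record IsIntegralDomain {c ℓ} (A : CommutativeRing c ℓ) : Set (c ⊔ ℓ) where
  open CommutativeRing A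
  field
    1≉0          : ¬ 1# ≈ 0#
    zero-product : ∀ x y → x * y ≈ 0# → x ≈ 0# ⊎ y ≈ 0#

module _ {c ℓ} (A : CommutativeRing c ℓ) where
  open CommutativeRing A

  record Ideal : Set (suc (c ⊔ ℓ)) where
    field
      member   : Pred Carrier (c ⊔ ℓ)
      member-≈ : ∀ {x y} → x ≈ y → member x → member y
      member-0 : member 0#
      member-+ : ∀ {x y} → member x → member y → member (x + y)
      member-* : ∀ a {x} → member x → member (a * x)

  open Ideal

  data Span (S : Pred Carrier (c ⊔ ℓ)) : Pred Carrier (c ⊔ ℓ) where
    gen    : ∀ {x} → S x → Span S x
    span-≈ : ∀ {x y} → x ≈ y → Span S x → Span S y
    span-0 : Span S 0#
    span-+ : ∀ {x y} → Span S x → Span S y → Span S (x + y)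
    span-* : ∀ a {x} → Span S x → Span S (a * x)

  span : Pred Carrier (c ⊔ ℓ) → Ideal
  span S = record
    { member = Span S ; member-≈ = span-≈ ; member-0 = span-0
    ; member-+ = span-+ ; member-* = span-* }

  infix 4 _≋_
  _≋_ : Ideal → Ideal → Set (c ⊔ ℓ)
  I ≋ J = member I ≐ member J

  ⟨_⟩ : Carrier → Ideal
  ⟨ r ⟩ = span (λ x → Lift (c ⊔ ℓ) (x ≈ r))

  ⟨_⟩ₗ : List Carrier → Ideal
  ⟨ rs ⟩ₗ = span (λ x → Lift (c ⊔ ℓ) (x ∈ rs))

  unitIdeal : Ideal
  unitIdeal = ⟨ 1# ⟩

  _⊗_ : Ideal → Ideal → Ideal
  I ⊗ J = span (λ x → ∃[ a ] ∃[ b ] member I a × member J b × x ≈ a * b)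

  product : List Ideal → Ideal
  product = foldr _⊗_ unitIdeal

  IsProper : Ideal → Set (c ⊔ ℓ)
  IsProper I = ¬ member I 1#

  IsNonzero : Ideal → Set (c ⊔ ℓ)
  IsNonzero I = ∃[ x ] member I x × ¬ x ≈ 0#

  record IsPrime (P : Ideal) : Set (c ⊔ ℓ) where
    field
      proper : IsProper P
      prime  : ∀ x y → member P (x * y) → member P x ⊎ member P y

  record IsMaximal (M : Ideal) : Set (suc (c ⊔ ℓ)) where
    field
      proper  : IsProper M
      maximal : ∀ J → IsProper J → member M ⊆ member J → M ≋ J

  IsNoetherian : Set (suc (c ⊔ ℓ))
  IsNoetherian = ∀ (I : Ideal) → ∃[ rs ] I ≋ ⟨ rs ⟩ₗ

  record IsPrincipalIdealDomain : Set (suc (c ⊔ ℓ)) where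
    field
      isIntegralDomain : IsIntegralDomain A
      principal        : ∀ (I : Ideal) → ∃[ r ] I ≋ ⟨ r ⟩

  IsLocal : Set (suc (c ⊔ ℓ))
  IsLocal = Σ[ M ∈ Ideal ] IsMaximal M × (∀ N → IsMaximal N → N ≋ M)

  record IsDiscreteValuationRing : Set (suc (c ⊔ ℓ)) where
    field
      isPrincipalIdealDomain : IsPrincipalIdealDomain
      isLocal                : IsLocal
      notField               : ¬ IsField A

record FractionField {c ℓ} (R : CommutativeRing c ℓ) k ℓₖ
       : Set (c ⊔ ℓ ⊔ suc (k ⊔ ℓₖ)) where
  private module R = CommutativeRing R
  field
    K : Field k ℓₖ
  private module K = Field K
  field
    ι              : R.Carrier → K.Carrier
    ι-monomorphism : IsRingMonomorphism R.rawRing K.rawRing ι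
    -- x = r / s
    fraction       : ∀ x → ∃[ r ] ∃[ s ] ¬ s R.≈ R.0# × x K.* ι s K.≈ ι r

module _ {c ℓ k ℓₖ} (R : CommutativeRing c ℓ) (F : FractionField R k ℓₖ) where
  private module R = CommutativeRing R
  open FractionField F
  private module K = Field K
  open import Algebra.Definitions.RawSemiring (Semiring.rawSemiring K.semiring) using (_^_; sum)

  -- x is a root of the monic polynomial Xⁿ + aₙ₋₁ Xⁿ⁻¹ + ⋯ + a₀ over R
  IsIntegral : K.Carrier → Set (c ⊔ ℓₖ)
  IsIntegral x = ∃[ n ] Σ[ a ∈ (Fin n → R.Carrier) ]
    x ^ n K.+ sum (λ i → ι (a i) K.* x ^ toℕ i) K.≈ K.0#

  IsIntegrallyClosed : Set (c ⊔ k ⊔ ℓₖ)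
  IsIntegrallyClosed = ∀ x → IsIntegral x → ∃[ r ] x K.≈ ι r

  record IsDedekindDomain : Set (suc (c ⊔ ℓ) ⊔ k ⊔ ℓₖ) where
    field
      isIntegralDomain   : IsIntegralDomain R
      isNoetherian       : IsNoetherian R
      isIntegrallyClosed : IsIntegrallyClosed
      prime⇒maximal      : ∀ P → IsNonzero R P → IsPrime R P → IsMaximal R P

-- ⊥₋ is the zero and [ n ] is of_add n
ℤₘ₀ : Set
ℤₘ₀ = ℤ ₋

pattern 0ₘ      = ⊥₋
pattern ofAdd n = [ n ]

1ₘ : ℤₘ₀
1ₘ = ofAdd 0ℤ

infixl 7 _·_
_·_ : ℤₘ₀ → ℤₘ₀ → ℤₘ₀
0ₘ      · β       = 0ₘ
ofAdd a · 0ₘ      = 0ₘ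
ofAdd a · ofAdd b = ofAdd (a ℤ.+ b)

open Inf using (_≤₋_; ⊥₋≤_) public

ℤₘ₀-totalOrder : TotalOrder 0ℓ 0ℓ 0ℓ
ℤₘ₀-totalOrder = record { isTotalOrder = Inf.≤₋-isTotalOrder-≡ ℤ.≤-isTotalOrder }

open import Algebra.Construct.NaturalChoice.Max ℤₘ₀-totalOrder public
  using () renaming (_⊔_ to max)

module _ {c ℓ} (A : CommutativeRing c ℓ) where
  open CommutativeRing A

  record IsValuation (v : Carrier → ℤₘ₀) : Set (c ⊔ ℓ) where
    field
      v-cong : ∀ {x y} → x ≈ y → v x ≡ v y
      v-0    : v 0# ≡ 0ₘ
      v-1    : v 1# ≡ 1ₘ
      v-*    : ∀ x y → v (x * y) ≡ v x · v y
      v-+    : ∀ x y → v (x + y) ≤₋ max (v x) (v y)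

  record Valuation : Set (c ⊔ ℓ) where
    constructor mkValuation
    field
      val         : Carrier → ℤₘ₀
      isValuation : IsValuation val
    open IsValuation isValuation public

  IsDiscrete : Valuation → Set (c ⊔ ℓ)
  IsDiscrete V = Surjective _≈_ _≡_ (Valuation.val V)

module _ (em : Classical) {c ℓ} (R : CommutativeRing c ℓ) where
  open CommutativeRing R

  Factorization : Carrier → Set (suc (c ⊔ ℓ))
  Factorization r = Σ[ Ps ∈ List (Ideal R) ]
    All (IsMaximal R) Ps × _≋_ R (⟨_⟩ R r) (product R Ps)

  multiplicity : Ideal R → List (Ideal R) → ℕ
  multiplicity 𝔪 Ps = length (filter (λ P → em {P = _≋_ R P 𝔪}) Ps)

  -- For nonzero r in a Dedekind domain (r) has a factorization, unique up to
  -- order, so neither the choice made by `em` nor the value 0 in the second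
  -- clause matters.
  exponent : Ideal R → Carrier → ℕ
  exponent 𝔪 r with em {P = Factorization r}
  ... | yes (Ps , _) = multiplicity 𝔪 Ps
  ... | no  _        = 0

  module _ {k ℓₖ} (F : FractionField R k ℓₖ) where
    open FractionField F
    private module K = Field K

    -- The value does not depend on the representation x = r / s, since the
    -- exponent is additive.
    adicValuation : Ideal R → K.Carrier → ℤₘ₀
    adicValuation 𝔪 x with em {P = x K.≈ K.0#}
    ... | yes _ = 0ₘ
    ... | no  _ = ofAdd (ℤ.- (+ exponent 𝔪 r ℤ.- + exponent 𝔪 s))
      where
      r = proj₁ (fraction x)
      s = proj₁ (proj₂ (fraction x))

module ℤₘ₀-Properties where
  module M where
    open TotalOrder ℤₘ₀-totalOrder public
      using (total; antisym) renaming (refl to ≤-refl; trans to ≤-trans; reflexive to ≤-reflexive)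
    open import Algebra.Construct.NaturalChoice.Max ℤₘ₀-totalOrder public
      using (⊔-lub; x≤x⊔y; x≤y⊔x)

  _≤?_ : ∀ α β → Dec (α ≤₋ β)
  _≤?_ = Inf.≤₋-dec ℤ._≤?_

  ≰⇒≥ : ∀ {α β} → ¬ α ≤₋ β → β ≤₋ α
  ≰⇒≥ {α} {β} α≰β = [ (λ α≤β → ⊥-elim (α≰β α≤β)) , (λ β≤α → β≤α) ]′ (M.total α β)

  ·-mono : ∀ {α α′ β β′} → α ≤₋ α′ → β ≤₋ β′ → α · β ≤₋ α′ · β′
  ·-mono (⊥₋≤ _) q         = ⊥₋≤ _
  ·-mono Inf.[ p ] (⊥₋≤ _) = ⊥₋≤ _
  ·-mono Inf.[ p ] Inf.[ q ] = Inf.[ ℤ.+-mono-≤ p q ]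

  ·-cancel : ∀ g γ → g ℤ.+ (γ ℤ.- g) ≡ γ
  ·-cancel g γ = trans (ℤ.+-comm g (γ ℤ.- g)) (trans (ℤ.+-assoc γ (ℤ.- g) g)
    (trans (cong (λ z → γ ℤ.+ z) (ℤ.+-inverseˡ g)) (ℤ.+-identityʳ γ)))

  ofAdd-≰ : ∀ g → ¬ ofAdd g ≤₋ ofAdd (ℤ.pred g)
  ofAdd-≰ g Inf.[ p ] = ℤ.<-irrefl refl (ℤ.i≤pred[j]⇒i<j p)

  ≤-pred : ∀ {α g} → ¬ ofAdd g ≤₋ α → α ≤₋ ofAdd (ℤ.pred g)
  ≤-pred {0ₘ}      g≰α = ⊥₋≤ _
  ≤-pred {ofAdd a} g≰α = Inf.[ ℤ.i<j⇒i≤pred[j] (ℤ.≰⇒> (λ g≤a → g≰α Inf.[ g≤a ])) ]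

  square-1 : ∀ α → α · α ≡ 1ₘ → α ≡ 1ₘ
  square-1 (ofAdd (+ 0))       refl = refl
  square-1 (ofAdd ℤ.+[1+ n ])  ()
  square-1 (ofAdd ℤ.-[1+ n ])  ()

  ·-inverse : ∀ g β → ofAdd g · β ≡ 1ₘ → β ≡ ofAdd (ℤ.- g)
  ·-inverse g (ofAdd b) eq = cong ofAdd (trans (sym (ℤ.+-identityˡ b)) (trans
    (cong (ℤ._+ b) (sym (ℤ.+-inverseˡ g))) (trans (ℤ.+-assoc (ℤ.- g) g b) (trans
    (cong (λ z → ℤ.- g ℤ.+ z) (ofAdd-injective eq)) (ℤ.+-identityʳ (ℤ.- g))))))
    where
    ofAdd-injective : ∀ {a b} → ofAdd a ≡ ofAdd b → a ≡ b
    ofAdd-injective refl = refl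

open ℤₘ₀-Properties

Eventually : (ℕ → Set) → Set
Eventually P = ∃[ N ] ∀ n → N ℕ.≤ n → P n

-- The sets {α : α ≤ γ} with γ ≠ 0 are a neighbourhood basis of 0, and every
-- nonzero point is isolated.
infix 4 _⟶_
_⟶_ : (ℕ → ℤₘ₀) → ℤₘ₀ → Set
s ⟶ 0ₘ      = ∀ γ → Eventually (λ n → s n ≤₋ ofAdd γ)
s ⟶ ofAdd g = Eventually (λ n → s n ≡ ofAdd g)

module ⟶-Properties where
  both : ∀ {P Q} → Eventually P → Eventually Q → Eventually (λ n → P n × Q n)
  both (M , p) (N , q) = M ℕ.⊔ N , λ n le →
    p n (ℕ.≤-trans (ℕ.m≤m⊔n M N) le) , q n (ℕ.≤-trans (ℕ.m≤n⊔m M N) le)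

  map-ev : ∀ {P Q : ℕ → Set} → (∀ n → P n → Q n) → Eventually P → Eventually Q
  map-ev f (N , p) = N , λ n le → f n (p n le)

  now : ∀ {P} → Eventually P → ∃ P
  now (N , p) = N , p N ℕ.≤-refl

  ⟶-cong : ∀ {s t} α → (∀ n → s n ≡ t n) → s ⟶ α → t ⟶ α
  ⟶-cong 0ₘ        s≡t lim γ = map-ev (λ n → subst (_≤₋ ofAdd γ) (s≡t n)) (lim γ)
  ⟶-cong (ofAdd g) s≡t lim   = map-ev (λ n → trans (sym (s≡t n))) lim

  ⟶-unique : ∀ {s} α β → s ⟶ α → s ⟶ β → α ≡ β
  ⟶-unique 0ₘ        0ₘ        p q = refl
  ⟶-unique 0ₘ        (ofAdd h) p q with now (both (p (ℤ.pred h)) q)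
  ... | n , le , eq = ⊥-elim (ofAdd-≰ h (subst (_≤₋ ofAdd (ℤ.pred h)) eq le))
  ⟶-unique (ofAdd g) 0ₘ        p q with now (both p (q (ℤ.pred g)))
  ... | n , eq , le = ⊥-elim (ofAdd-≰ g (subst (_≤₋ ofAdd (ℤ.pred g)) eq le))
  ⟶-unique (ofAdd g) (ofAdd h) p q with now (both p q)
  ... | n , eq , eq′ = trans (sym eq) eq′

  ⟶-· : ∀ {s t} α β → s ⟶ α → t ⟶ β → (λ n → s n · t n) ⟶ (α · β)
  ⟶-· 0ₘ 0ₘ p q γ = map-ev
    (λ n (a , b) → subst (λ z → _ ≤₋ ofAdd z) (ℤ.+-identityʳ γ) (·-mono a b))
    (both (p γ) (q 0ℤ))
  ⟶-· 0ₘ (ofAdd h) p q γ = map-ev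
    (λ n (a , b) → subst (λ z → _ ≤₋ ofAdd z)
      (trans (ℤ.+-comm (γ ℤ.- h) h) (·-cancel h γ))
      (·-mono a (M.≤-reflexive b)))
    (both (p (γ ℤ.- h)) q)
  ⟶-· (ofAdd g) 0ₘ p q γ = map-ev
    (λ n (a , b) → subst (λ z → _ ≤₋ ofAdd z) (·-cancel g γ)
      (·-mono (M.≤-reflexive a) b))
    (both p (q (γ ℤ.- g)))
  ⟶-· (ofAdd g) (ofAdd h) p q =
    map-ev (λ n (a , b) → cong₂ _·_ a b) (both p q)

  ⟶-≤ : ∀ {s} α γ → s ⟶ α → α ≤₋ ofAdd γ → Eventually (λ n → s n ≤₋ ofAdd γ)
  ⟶-≤ 0ₘ        γ p le = p γ
  ⟶-≤ (ofAdd g) γ p le = map-ev (λ n eq → subst (_≤₋ ofAdd γ) (sym eq) le) p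

  ⟶-max : ∀ {s t u} α β δ → s ⟶ α → t ⟶ β → u ⟶ δ →
          (∀ n → u n ≤₋ max (s n) (t n)) → δ ≤₋ max α β
  ⟶-max α β 0ₘ        p q r le = ⊥₋≤ _
  ⟶-max α β (ofAdd d) p q r le with ofAdd d ≤? max α β
  ... | yes d≤ = d≤
  ... | no  d≰ with now (both r (both
          (⟶-≤ α (ℤ.pred d) p (M.≤-trans (M.x≤x⊔y α β) (≤-pred d≰)))
          (⟶-≤ β (ℤ.pred d) q (M.≤-trans (M.x≤y⊔x α β) (≤-pred d≰)))))
  ... | n , eq , a , b = ⊥-elim (ofAdd-≰ d
          (subst (_≤₋ ofAdd (ℤ.pred d)) eq (M.≤-trans (le n) (M.⊔-lub a b))))

open ⟶-Properties

module Ultrametric {c ℓ} (A : CommutativeRing c ℓ) (V : Valuation A) where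
  open CommutativeRing A renaming (refl to ≈-refl; sym to ≈-sym; trans to ≈-trans)
  open import Algebra.Properties.Ring ring
  open import Relation.Binary.Reasoning.Setoid setoid
  open Valuation V renaming (val to v)

  telescope : ∀ x y z → (x - y) + (y - z) ≈ x - z
  telescope x y z = begin
    (x - y) + (y - z)     ≈⟨ +-assoc x (- y) (y - z) ⟩
    x + (- y + (y - z))   ≈⟨ +-congˡ (≈-sym (+-assoc (- y) y (- z))) ⟩
    x + ((- y + y) - z)   ≈⟨ +-congˡ (+-congʳ (-‿inverseˡ y)) ⟩
    x + (0# - z)          ≈⟨ +-congˡ (+-identityˡ (- z)) ⟩
    x - z                 ∎

  restore : ∀ x y → (x - y) + y ≈ x
  restore x y = begin
    (x - y) + y     ≈⟨ +-assoc x (- y) y ⟩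
    x + (- y + y)   ≈⟨ +-congˡ (-‿inverseˡ y) ⟩
    x + 0#          ≈⟨ +-identityʳ x ⟩
    x               ∎

  x-0≈x : ∀ x → x - 0# ≈ x
  x-0≈x x = ≈-trans (+-congˡ -0#≈0#) (+-identityʳ x)

  neg-sub : ∀ x y → - (x - y) ≈ y - x
  neg-sub x y = begin
    - (x - y)      ≈⟨ ≈-sym (-‿+-comm x (- y)) ⟩
    - x + - - y    ≈⟨ +-congˡ (-‿involutive y) ⟩
    - x + y        ≈⟨ +-comm (- x) y ⟩
    y - x          ∎

  add-sub : ∀ x y x′ y′ → (x + y) - (x′ + y′) ≈ (x - x′) + (y - y′)
  add-sub x y x′ y′ = begin
    (x + y) - (x′ + y′)         ≈⟨ +-congˡ (≈-sym (-‿+-comm x′ y′)) ⟩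
    (x + y) + (- x′ + - y′)     ≈⟨ +-assoc x y _ ⟩
    x + (y + (- x′ + - y′))     ≈⟨ +-congˡ (≈-sym (+-assoc y _ _)) ⟩
    x + ((y + - x′) + - y′)     ≈⟨ +-congˡ (+-congʳ (+-comm y _)) ⟩
    x + ((- x′ + y) + - y′)     ≈⟨ +-congˡ (+-assoc _ y _) ⟩
    x + (- x′ + (y + - y′))     ≈⟨ ≈-sym (+-assoc x _ _) ⟩
    (x - x′) + (y - y′)         ∎

  mul-sub : ∀ x y x′ y′ → x * y - x′ * y′ ≈ x * (y - y′) + (x - x′) * y′
  mul-sub x y x′ y′ = ≈-sym (≈-trans
    (+-cong (x[y-z]≈xy-xz x y y′) ([y-z]x≈yx-zx y′ x x′))
    (telescope (x * y) (x * y′) (x′ * y′)))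

  inv-sub : ∀ {x y x′ y′} → x * y ≈ 1# → x′ * y′ ≈ 1# →
            y - y′ ≈ (x′ - x) * (y * y′)
  inv-sub {x} {y} {x′} {y′} xy x′y′ = ≈-sym (≈-trans
    ([y-z]x≈yx-zx (y * y′) x′ x) (+-cong first (-‿cong second)))
    where
    first : x′ * (y * y′) ≈ y
    first = begin
      x′ * (y * y′)   ≈⟨ *-congˡ (*-comm y y′) ⟩
      x′ * (y′ * y)   ≈⟨ ≈-sym (*-assoc x′ y′ y) ⟩
      (x′ * y′) * y   ≈⟨ *-congʳ x′y′ ⟩
      1# * y          ≈⟨ *-identityˡ y ⟩
      y               ∎
    second : x * (y * y′) ≈ y′
    second = begin
      x * (y * y′)    ≈⟨ ≈-sym (*-assoc x y y′) ⟩
      (x * y) * y′    ≈⟨ *-congʳ xy ⟩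
      1# * y′         ≈⟨ *-identityˡ y′ ⟩
      y′              ∎

  v-neg : ∀ x → v (- x) ≡ v x
  v-neg x = trans (v-cong (≈-sym (-1*x≈-x x))) (trans (v-* (- 1#) x)
    (trans (cong (_· v x) v-neg-1) (trans (sym (cong (_· v x) v-1))
    (trans (sym (v-* 1# x)) (v-cong (*-identityˡ x))))))
    where
    v-neg-1 : v (- 1#) ≡ 1ₘ
    v-neg-1 = square-1 (v (- 1#)) (trans (sym (v-* _ _))
      (trans (v-cong (≈-trans (-1*x≈-x (- 1#)) (-‿involutive 1#))) v-1))

  v-flip : ∀ x y → v (x - y) ≡ v (y - x)
  v-flip x y = trans (sym (v-neg (x - y))) (v-cong (neg-sub x y))

  +-≤ : ∀ {x y γ} → v x ≤₋ γ → v y ≤₋ γ → v (x + y) ≤₋ γ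
  +-≤ p q = M.≤-trans (v-+ _ _) (M.⊔-lub p q)

  ≈-≤ : ∀ {x y γ} → x ≈ y → v y ≤₋ γ → v x ≤₋ γ
  ≈-≤ x≈y = subst (_≤₋ _) (sym (v-cong x≈y))

  *-≤ : ∀ {x y γ δ} → v x ≤₋ γ → v y ≤₋ δ → v (x * y) ≤₋ γ · δ
  *-≤ p q = subst (_≤₋ _) (sym (v-* _ _)) (·-mono p q)

  close-≤ : ∀ {x y γ} → v (x - y) ≤₋ γ → v y ≤₋ γ → v x ≤₋ γ
  close-≤ {x} {y} p q = ≈-≤ (≈-sym (restore x y)) (+-≤ p q)

  close-≡ : ∀ {x y γ} → v (x - y) ≤₋ γ → ¬ v x ≤₋ γ → v x ≡ v y
  close-≡ {x} {y} {γ} p vx≰γ = M.antisym vx≤vy vy≤vx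
    where
    vx≤vy : v x ≤₋ v y
    vx≤vy with v y ≤? γ
    ... | yes vy≤γ = ⊥-elim (vx≰γ (close-≤ p vy≤γ))
    ... | no  vy≰γ = close-≤ (M.≤-trans p (≰⇒≥ vy≰γ)) M.≤-refl
    vy≤vx : v y ≤₋ v x
    vy≤vx = close-≤ (subst (_≤₋ v x) (v-flip x y) (M.≤-trans p (≰⇒≥ vx≰γ))) M.≤-refl

-- The sets {x : v x ≤ γ} with γ ≠ 0 form a countable neighbourhood basis of 0,
-- so the completion is the set of Cauchy sequences modulo null sequences.
module Completion (em : Classical) {c ℓ} (K : Field c ℓ)
                  (V : Valuation (Field.commutativeRing K)) where
  open Field K renaming (refl to ≈-refl; sym to ≈-sym; trans to ≈-trans)
  open Valuation V renaming (val to v)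
  private open module U = Ultrametric commutativeRing V
  open import Algebra.Properties.Ring ring

  record CauchySequence : Set c where
    field
      term   : ℕ → Carrier
      cauchy : ∀ γ → ∃[ N ] ∀ m n → N ℕ.≤ m → N ℕ.≤ n → v (term m - term n) ≤₋ ofAdd γ
  open CauchySequence

  infix 4 _≈̂_
  _≈̂_ : CauchySequence → CauchySequence → Set
  x ≈̂ y = (λ n → v (term x n - term y n)) ⟶ 0ₘ

  C₂ : (ℕ → ℕ → Carrier) → ℤ → Set
  C₂ d γ = ∃[ N ] ∀ m n → N ℕ.≤ m → N ℕ.≤ n → v (d m n) ≤₋ ofAdd γ

  pointwise : ∀ {x y} → (∀ n → term x n ≈ term y n) → x ≈̂ y
  pointwise {x} {y} eq γ = 0 , λ n _ → ≈-≤ (≈-trans (+-congʳ (eq n)) (-‿inverseʳ _))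
    (subst (_≤₋ ofAdd γ) (sym v-0) (⊥₋≤ _))

  bounded : ∀ x → ∃[ β ] Eventually (λ n → v (term x n) ≤₋ ofAdd β)
  bounded x with cauchy x 0ℤ
  ... | N , p with v (term x N) in eq
  ...   | 0ₘ      = 0ℤ , N , λ n N≤n →
            close-≤ (p n N N≤n ℕ.≤-refl) (subst (_≤₋ 1ₘ) (sym eq) (⊥₋≤ _))
  ...   | ofAdd b = 0ℤ ℤ.⊔ b , N , λ n N≤n → close-≤
            (M.≤-trans (p n N N≤n ℕ.≤-refl) Inf.[ ℤ.i≤i⊔j 0ℤ b ])
            (subst (_≤₋ ofAdd (0ℤ ℤ.⊔ b)) (sym eq) Inf.[ ℤ.i≤j⊔i 0ℤ b ])

  small-product : ∀ {β γ δ x y} → β ℤ.+ γ ≡ δ →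
                  v x ≤₋ ofAdd β → v y ≤₋ ofAdd γ → v (x * y) ≤₋ ofAdd δ
  small-product refl p q = *-≤ p q

  -+-cancel : ∀ β γ → (γ ℤ.- β) ℤ.+ β ≡ γ
  -+-cancel β γ = trans (ℤ.+-comm (γ ℤ.- β) β) (·-cancel β γ)

  constant : Carrier → CauchySequence
  constant a = record
    { term   = λ _ → a
    ; cauchy = λ γ → 0 , λ _ _ _ _ → ≈-≤ (-‿inverseʳ a) (subst (_≤₋ ofAdd γ) (sym v-0) (⊥₋≤ _)) }

  _+̂_ : CauchySequence → CauchySequence → CauchySequence
  x +̂ y = record
    { term   = λ n → term x n + term y n
    ; cauchy = cauchy-+ }
    where
    cauchy-+ : ∀ γ → C₂ (λ m n → (term x m + term y m) - (term x n + term y n)) γ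
    cauchy-+ γ with cauchy x γ | cauchy y γ
    ... | M , p | N , q = M ℕ.⊔ N , λ m n lm ln → ≈-≤ (add-sub _ _ _ _) (+-≤
      (p m n (ℕ.m⊔n≤o⇒m≤o M N lm) (ℕ.m⊔n≤o⇒m≤o M N ln))
      (q m n (ℕ.m⊔n≤o⇒n≤o M N lm) (ℕ.m⊔n≤o⇒n≤o M N ln)))

  -̂_ : CauchySequence → CauchySequence
  -̂ x = record
    { term   = λ n → - term x n
    ; cauchy = cauchy-neg }
    where
    cauchy-neg : ∀ γ → C₂ (λ m n → - term x m - - term x n) γ
    cauchy-neg γ with cauchy x γ
    ... | N , p = N , λ m n lm ln → ≈-≤ (-‿+-comm _ _)
      (subst (_≤₋ ofAdd γ) (sym (v-neg _)) (p m n lm ln))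

  _*̂_ : CauchySequence → CauchySequence → CauchySequence
  x *̂ y = record
    { term   = λ n → term x n * term y n
    ; cauchy = cauchy-* }
    where
    cauchy-* : ∀ γ → C₂ (λ m n → term x m * term y m - term x n * term y n) γ
    cauchy-* γ with bounded x | bounded y
    ... | β , N₁ , bx | δ , N₂ , by with cauchy x (γ ℤ.- δ) | cauchy y (γ ℤ.- β)
    ... | N₃ , p | N₄ , q = L , λ m n lm ln → ≈-≤ (mul-sub _ _ _ _) (+-≤
      (small-product (·-cancel β γ) (bx m (le₁ lm)) (q m n (le₄ lm) (le₄ ln)))
      (small-product (-+-cancel δ γ) (p m n (le₃ lm) (le₃ ln)) (by n (le₂ ln))))
      where
      L = (N₁ ℕ.⊔ N₂) ℕ.⊔ (N₃ ℕ.⊔ N₄)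
      module _ {n} (L≤n : L ℕ.≤ n) where
        l = ℕ.m⊔n≤o⇒m≤o (N₁ ℕ.⊔ N₂) (N₃ ℕ.⊔ N₄) L≤n
        r = ℕ.m⊔n≤o⇒n≤o (N₁ ℕ.⊔ N₂) (N₃ ℕ.⊔ N₄) L≤n
        le₁ = ℕ.m⊔n≤o⇒m≤o N₁ N₂ l
        le₂ = ℕ.m⊔n≤o⇒n≤o N₁ N₂ l
        le₃ = ℕ.m⊔n≤o⇒m≤o N₃ N₄ r
        le₄ = ℕ.m⊔n≤o⇒n≤o N₃ N₄ r

  ≈̂-sym : ∀ {x y} → x ≈̂ y → y ≈̂ x
  ≈̂-sym p γ = map-ev (λ n → subst (_≤₋ ofAdd γ) (v-flip _ _)) (p γ)

  ≈̂-trans : ∀ {x y z} → x ≈̂ y → y ≈̂ z → x ≈̂ z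
  ≈̂-trans p q γ = map-ev
    (λ n (a , b) → ≈-≤ (≈-sym (telescope _ _ _)) (+-≤ a b)) (both (p γ) (q γ))

  +̂-cong : ∀ {x x′ y y′} → x ≈̂ x′ → y ≈̂ y′ → (x +̂ y) ≈̂ (x′ +̂ y′)
  +̂-cong p q γ = map-ev
    (λ n (a , b) → ≈-≤ (add-sub _ _ _ _) (+-≤ a b)) (both (p γ) (q γ))

  -̂-cong : ∀ {x x′} → x ≈̂ x′ → (-̂ x) ≈̂ (-̂ x′)
  -̂-cong p γ = map-ev
    (λ n a → ≈-≤ (-‿+-comm _ _) (subst (_≤₋ ofAdd γ) (sym (v-neg _)) a)) (p γ)

  *̂-cong : ∀ {x x′ y y′} → x ≈̂ x′ → y ≈̂ y′ → (x *̂ y) ≈̂ (x′ *̂ y′)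
  *̂-cong {x} {x′} {y} {y′} p q γ with bounded x | bounded y′
  ... | β , bx | δ , by = map-ev
    (λ n ((a , b) , (d , e)) → ≈-≤ (mul-sub _ _ _ _) (+-≤
      (small-product (·-cancel β γ) a d)
      (small-product (-+-cancel δ γ) e b)))
    (both (both bx by) (both (q (γ ℤ.- β)) (p (γ ℤ.- δ))))

  completionRing : CommutativeRing c 0ℓ
  completionRing = record
    { Carrier = CauchySequence
    ; _≈_ = _≈̂_
    ; _+_ = _+̂_
    ; _*_ = _*̂_
    ; -_  = -̂_
    ; 0#  = constant 0#
    ; 1#  = constant 1#
    ; isCommutativeRing = record
      { isRing = record
        { +-isAbelianGroup = record
          { isGroup = record
            { isMonoid = record
              { isSemigroup = record
                { isMagma = record
                  { isEquivalence = record
                    { refl  = λ {x} → pointwise {x} {x} λ n → ≈-refl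
                    ; sym   = λ {x} {y} → ≈̂-sym {x} {y}
                    ; trans = λ {x} {y} {z} → ≈̂-trans {x} {y} {z} }
                  ; ∙-cong = λ {x} {x′} {y} {y′} → +̂-cong {x} {x′} {y} {y′} }
                ; assoc = λ x y z → pointwise {(x +̂ y) +̂ z} {x +̂ (y +̂ z)} λ n → +-assoc _ _ _ }
              ; identity = (λ x → pointwise {constant 0# +̂ x} {x} λ n → +-identityˡ _)
                         , (λ x → pointwise {x +̂ constant 0#} {x} λ n → +-identityʳ _) }
            ; inverse = (λ x → pointwise {(-̂ x) +̂ x} {constant 0#} λ n → -‿inverseˡ _)
                      , (λ x → pointwise {x +̂ (-̂ x)} {constant 0#} λ n → -‿inverseʳ _)
            ; ⁻¹-cong = λ {x} {x′} → -̂-cong {x} {x′} }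
          ; comm = λ x y → pointwise {x +̂ y} {y +̂ x} λ n → +-comm _ _ }
        ; *-cong = λ {x} {x′} {y} {y′} → *̂-cong {x} {x′} {y} {y′}
        ; *-assoc = λ x y z → pointwise {(x *̂ y) *̂ z} {x *̂ (y *̂ z)} λ n → *-assoc _ _ _
        ; *-identity = (λ x → pointwise {constant 1# *̂ x} {x} λ n → *-identityˡ _)
                     , (λ x → pointwise {x *̂ constant 1#} {x} λ n → *-identityʳ _)
        ; distrib = (λ x y z → pointwise {x *̂ (y +̂ z)} {(x *̂ y) +̂ (x *̂ z)} λ n → distribˡ _ _ _)
                  , (λ x y z → pointwise {(y +̂ z) *̂ x} {(y *̂ x) +̂ (z *̂ x)} λ n → distribʳ _ _ _) }
      ; *-comm = λ x y → pointwise {x *̂ y} {y *̂ x} λ n → *-comm _ _ } }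

  limit : ∀ x → ∃[ α ] (λ n → v (term x n)) ⟶ α
  limit x with em {P = (λ n → v (term x n)) ⟶ 0ₘ}
  ... | yes null = 0ₘ , null
  ... | no ¬null with em {P = ∃[ γ ] ¬ Eventually (λ n → v (term x n) ≤₋ ofAdd γ)}
  ...   | no ¬∃ = ⊥-elim (¬null λ γ → stable (λ ¬ev → ¬∃ (γ , ¬ev)))
    where
    stable : ∀ {P : Set} → ¬ ¬ P → P
    stable {P} ¬¬p with em {P = P}
    ... | yes p = p
    ... | no ¬p = ⊥-elim (¬¬p ¬p)
  ...   | yes (γ , ¬ev) with cauchy x γ
  ...     | N , p with em {P = ∃[ n ] N ℕ.≤ n × ¬ v (term x n) ≤₋ ofAdd γ}
  ...       | no ¬∃ = ⊥-elim (¬ev (N , small))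
    where
    small : ∀ n → N ℕ.≤ n → v (term x n) ≤₋ ofAdd γ
    small n N≤n with v (term x n) ≤? ofAdd γ
    ... | yes le = le
    ... | no ≰   = ⊥-elim (¬∃ (n , N≤n , ≰))
  ...       | yes (n , N≤n , ≰γ) with v (term x n) in eq
  ...         | 0ₘ      = ⊥-elim (≰γ (⊥₋≤ _))
  ...         | ofAdd g = ofAdd g , N , λ m N≤m → trans
    (sym (close-≡ (p n m N≤n N≤m) (λ le → ≰γ (subst (_≤₋ ofAdd γ) eq le)))) eq

  -- the unique continuous extension of v, as α above is unique
  v̂ : CauchySequence → ℤₘ₀
  v̂ x = proj₁ (limit x)

  v̂-limit : ∀ x → (λ n → v (term x n)) ⟶ v̂ x
  v̂-limit x = proj₂ (limit x)

  limit-unique : ∀ x α → (λ n → v (term x n)) ⟶ α → v̂ x ≡ α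
  limit-unique x α = ⟶-unique (v̂ x) α (v̂-limit x)

  v̂-constant : ∀ a → v̂ (constant a) ≡ v a
  v̂-constant a = limit-unique (constant a) (v a) (const-⟶ (v a))
    where
    const-⟶ : ∀ α → (λ _ → α) ⟶ α
    const-⟶ 0ₘ        γ = 0 , λ _ _ → ⊥₋≤ _
    const-⟶ (ofAdd g)   = 0 , λ _ _ → refl

  ⟶-≈̂ : ∀ x y α → x ≈̂ y → (λ n → v (term x n)) ⟶ α → (λ n → v (term y n)) ⟶ α
  ⟶-≈̂ x y 0ₘ p lim γ = map-ev
    (λ n (a , b) → close-≤ (subst (_≤₋ ofAdd γ) (v-flip _ _) a) b) (both (p γ) (lim γ))
  ⟶-≈̂ x y (ofAdd g) p lim = map-ev
    (λ n (a , b) → trans (sym (close-≡ a (λ le →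
      ofAdd-≰ g (subst (_≤₋ ofAdd (ℤ.pred g)) b le)))) b)
    (both (p (ℤ.pred g)) lim)

  v̂-isValuation : IsValuation completionRing v̂
  v̂-isValuation = record
    { v-cong = λ {x} {y} x≈y → sym (limit-unique y (v̂ x) (⟶-≈̂ x y (v̂ x) x≈y (v̂-limit x)))
    ; v-0    = trans (v̂-constant 0#) v-0
    ; v-1    = trans (v̂-constant 1#) v-1
    ; v-*    = λ x y → limit-unique (x *̂ y) (v̂ x · v̂ y)
        (⟶-cong (v̂ x · v̂ y) (λ n → sym (v-* _ _)) (⟶-· (v̂ x) (v̂ y) (v̂-limit x) (v̂-limit y)))
    ; v-+    = λ x y → ⟶-max (v̂ x) (v̂ y) (v̂ (x +̂ y)) (v̂-limit x) (v̂-limit y)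
        (v̂-limit (x +̂ y)) (λ n → v-+ _ _) }

  completionIsField : IsField completionRing
  completionIsField = record { 1≉0 = 1̂≉0̂ ; inverse = inversê }
    where
    1̂≉0̂ : ¬ constant 1# ≈̂ constant 0#
    1̂≉0̂ p with now (p (ℤ.pred 0ℤ))
    ... | n , le = ofAdd-≰ 0ℤ (subst (_≤₋ _) (trans (v-cong (x-0≈x 1#)) v-1) le)

    inv : Carrier → Carrier
    inv a with em {P = a ≈ 0#}
    ... | yes _  = 0#
    ... | no a≉0 = proj₁ (inverse a a≉0)

    inv-inverse : ∀ a → ¬ a ≈ 0# → a * inv a ≈ 1#
    inv-inverse a a≉0 with em {P = a ≈ 0#}
    ... | yes a≈0 = ⊥-elim (a≉0 a≈0)
    ... | no a≉0′ = proj₂ (inverse a a≉0′)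

    inversê : ∀ x → ¬ x ≈̂ constant 0# → ∃[ y ] (x *̂ y) ≈̂ constant 1#
    inversê x x≉0 with limit x
    ... | 0ₘ , lim = ⊥-elim (x≉0 (⟶-cong 0ₘ (λ n → sym (v-cong (x-0≈x _))) lim))
    ... | ofAdd g , N , vx≡g = y , xy≈1
      where
      is-inverse : ∀ n → N ℕ.≤ n → term x n * inv (term x n) ≈ 1#
      is-inverse n N≤n = inv-inverse _ λ x≈0 → 0≢g (trans (sym v-0) (trans (v-cong (≈-sym x≈0)) (vx≡g n N≤n)))
        where
        0≢g : ¬ 0ₘ ≡ ofAdd g
        0≢g ()

      v-inv : ∀ n → N ℕ.≤ n → v (inv (term x n)) ≡ ofAdd (ℤ.- g)
      v-inv n N≤n = ·-inverse g _ (trans (cong (_· v (inv (term x n))) (sym (vx≡g n N≤n)))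
        (trans (sym (v-* _ _)) (trans (v-cong (is-inverse n N≤n)) v-1)))

      cauchy-inv : ∀ γ → C₂ (λ m n → inv (term x m) - inv (term x n)) γ
      cauchy-inv γ with cauchy x (γ ℤ.- (ℤ.- g ℤ.+ ℤ.- g))
      ... | L , p = L ℕ.⊔ N , λ m n lm ln →
        let lm′ = ℕ.m⊔n≤o⇒n≤o L N lm
            ln′ = ℕ.m⊔n≤o⇒n≤o L N ln
        in ≈-≤ (inv-sub (is-inverse m lm′) (is-inverse n ln′))
             (small-product (-+-cancel (ℤ.- g ℤ.+ ℤ.- g) γ)
               (p n m (ℕ.m⊔n≤o⇒m≤o L N ln) (ℕ.m⊔n≤o⇒m≤o L N lm))
               (*-≤ (M.≤-reflexive (v-inv m lm′)) (M.≤-reflexive (v-inv n ln′))))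

      y : CauchySequence
      y = record { term = λ n → inv (term x n) ; cauchy = cauchy-inv }

      xy≈1 : (x *̂ y) ≈̂ constant 1#
      xy≈1 γ = N , λ n N≤n → ≈-≤ (≈-trans (+-congʳ (is-inverse n N≤n)) (-‿inverseʳ 1#))
        (subst (_≤₋ ofAdd γ) (sym v-0) (⊥₋≤ _))

module _ (em : Classical) {c ℓ} (K : Field c ℓ)
         (V : Valuation (Field.commutativeRing K)) where
  open Completion em K V

  completion : Field c 0ℓ
  completion = record { commutativeRing = completionRing ; isField = completionIsField }

  completedValuation : Valuation (Field.commutativeRing completion)
  completedValuation = record { val = v̂ ; isValuation = v̂-isValuation }

module _ {c ℓ} (A : CommutativeRing c ℓ) (V : Valuation A) where
  open CommutativeRing A using (Carrier; _≈_; _+_; _*_; -_; 0#; 1#) renaming (refl to ≈-refl)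
  open Valuation V renaming (val to v)
  private open module U = Ultrametric A V

  unitBall : CommutativeRing c ℓ
  unitBall = record { isCommutativeRing = isCommutativeRing A.isCommutativeRing }
    where
    module A = CommutativeRing A

    Ball : Set c
    Ball = Σ[ x ∈ Carrier ] v x ≤₋ 1ₘ

    ballRawRing : RawRing c ℓ
    ballRawRing = record
      { Carrier = Ball
      ; _≈_ = λ (x , _) (y , _) → x ≈ y
      ; _+_ = λ (x , p) (y , q) → x + y , +-≤ p q
      ; _*_ = λ (x , p) (y , q) → x * y , *-≤ p q
      ; -_  = λ (x , p) → - x , subst (_≤₋ 1ₘ) (sym (v-neg x)) p
      ; 0#  = 0# , subst (_≤₋ 1ₘ) (sym v-0) (⊥₋≤ _)
      ; 1#  = 1# , M.≤-reflexive v-1 }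

    inclusion : IsRingMonomorphism ballRawRing A.rawRing proj₁
    inclusion = record
      { isRingHomomorphism = record
        { isSemiringHomomorphism = record
          { isNearSemiringHomomorphism = record
            { +-isMonoidHomomorphism = record
              { isMagmaHomomorphism = record
                { isRelHomomorphism = record { cong = λ p → p }
                ; homo = λ _ _ → ≈-refl }
              ; ε-homo = ≈-refl }
            ; *-homo = λ _ _ → ≈-refl }
          ; 1#-homo = ≈-refl }
        ; -‿homo = λ _ → ≈-refl }
      ; injective = λ p → p }

    open import Algebra.Morphism.RingMonomorphism inclusion using (isCommutativeRing)

{-# OPTIONS --safe #-}

-- Idea.  For P maximal and 0 ≠ a ∈ P, an ideal (a : b) maximal among those
-- contained in P is prime, hence equal to P; so b / a ∈ P⁻¹ \ R.  Multiplication
-- by b / a cannot preserve a nonzero ideal, since b / a would then be integral.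
-- Hence some π ∈ P has t = (b / a) π ∈ R \ P, and t P ⊆ (π): P is invertible
-- and locally generated by π.  Noetherian induction along I = P (I : P) gives
-- the factorizations.  Up to elements outside 𝔪, a product of maximal ideals
-- containing 𝔪 exactly n times is (πⁿ), so that r = u πⁿ with u a unit at 𝔪 and
-- n the exponent of r; from this normal form the valuation laws can be read off.
-- In the completion the values are those already attained on K, and the unit
-- ball of any field with a discrete valuation is a discrete valuation ring.
module Submission where

open import Defs
open import Algebra.Bundles using (CommutativeMonoid; CommutativeRing)
open import Algebra.Morphism.Structures using (IsRingMonomorphism)
open import Data.Empty using (⊥-elim)
open import Data.Fin.Base using (Fin; zero; suc; toℕ)
open import Data.Integer.Base as ℤ using (ℤ; 0ℤ; +_; -[1+_])
import Data.Integer.Properties as ℤ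
open import Data.List.Base using (List; []; _∷_)
open import Data.List.Membership.Propositional using (_∈_)
open import Data.List.Relation.Unary.All using (All; []; _∷_)
open import Data.List.Relation.Unary.Any using (here; there)
open import Data.Nat.Base as ℕ using (ℕ; zero; suc)
open import Data.Nat.Induction using (<-rec)
import Data.Nat.Properties as ℕ
open import Data.Product using (Σ-syntax; ∃-syntax; _×_; _,_; proj₁; proj₂)
open import Data.Sum.Base using (_⊎_; inj₁; inj₂; [_,_]′)
import Data.Vec.Functional as Vector
open import Function.Base using (_∘_)
open import Level using (Lift; lift; _⊔_)
import Relation.Binary.Construct.Add.Infimum.NonStrict ℤ._≤_ as Inf
open import Relation.Binary.PropositionalEquality
  using (_≡_; refl; sym; trans; cong; cong₂; subst; subst₂; module ≡-Reasoning)
open import Relation.Nullary using (¬_; yes; no)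
open import Relation.Nullary.Decidable using (toSum)
open import Relation.Unary using (Pred; _⊆_)

-- Classical reasoning

module Logic (em : Classical) where

  -- Applied to a `Σ`-type this yields a witness, so that data can be obtained by contradiction.
  stable : ∀ {a} {A : Set a} → ¬ ¬ A → A
  stable {A = A} ¬¬a with em {P = A}
  ... | yes a = a
  ... | no ¬a = ⊥-elim (¬¬a ¬a)

  ⊈⇒∃ : ∀ {a p q} {A : Set a} {P : Pred A p} {Q : Pred A q} →
        ¬ P ⊆ Q → ∃[ x ] P x × ¬ Q x
  ⊈⇒∃ P⊈Q = stable λ ¬∃ → P⊈Q λ {x} Px → stable λ ¬Qx → ¬∃ (x , Px , ¬Qx)

-- Ideals of a commutative ring

module Ideals (em : Classical) {c ℓ} (R : CommutativeRing c ℓ) where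
  open CommutativeRing R
    renaming (refl to ≈-refl; sym to ≈-sym; trans to ≈-trans)
  open Logic em
  open Ideal
  open import Relation.Binary.Reasoning.Setoid setoid
  open import Algebra.Properties.CommutativeSemigroup *-commutativeSemigroup
    using (x∙yz≈y∙xz)

  span-least : ∀ (I : Ideal R) {S : Pred Carrier (c ⊔ ℓ)} → S ⊆ member I → Span R S ⊆ member I
  span-least I S⊆I (gen s)        = S⊆I s
  span-least I S⊆I (span-≈ x≈y s) = member-≈ I x≈y (span-least I S⊆I s)
  span-least I S⊆I span-0         = member-0 I
  span-least I S⊆I (span-+ s t)   = member-+ I (span-least I S⊆I s) (span-least I S⊆I t)
  span-least I S⊆I (span-* a s)   = member-* I a (span-least I S⊆I s)

  -- The principal ideal again, but membership carries the cofactor `q`, which the inductive `Span`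
  -- does not expose.
  multiples : Carrier → Ideal R
  multiples a = record
    { member   = λ x → ∃[ q ] x ≈ q * a
    ; member-≈ = λ x≈y (q , x≈qa) → q , ≈-trans (≈-sym x≈y) x≈qa
    ; member-0 = 0# , ≈-sym (zeroˡ a)
    ; member-+ = λ (q , x≈qa) (r , y≈ra) → q + r ,
        ≈-trans (+-cong x≈qa y≈ra) (≈-sym (distribʳ a q r))
    ; member-* = λ b (q , x≈qa) → b * q , ≈-trans (*-congˡ x≈qa) (≈-sym (*-assoc b q a)) }

  ⟨⟩⊆multiples : ∀ a → member (⟨_⟩ R a) ⊆ member (multiples a)
  ⟨⟩⊆multiples a = span-least (multiples a)
    λ (lift x≈a) → 1# , ≈-trans x≈a (≈-sym (*-identityˡ a))

  multiples⊆⟨⟩ : ∀ a → member (multiples a) ⊆ member (⟨_⟩ R a)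
  multiples⊆⟨⟩ a (q , x≈qa) = span-≈ (≈-sym x≈qa) (span-* q (gen (lift ≈-refl)))

  colon : Ideal R → Carrier → Ideal R
  colon I b = record
    { member   = λ x → member I (b * x)
    ; member-≈ = λ x≈y → member-≈ I (*-congˡ x≈y)
    ; member-0 = member-≈ I (≈-sym (zeroʳ b)) (member-0 I)
    ; member-+ = λ p q → member-≈ I (≈-sym (distribˡ b _ _)) (member-+ I p q)
    ; member-* = λ a p → member-≈ I (x∙yz≈y∙xz a b _) (member-* I a p) }

  -- The ideal quotient (I : P), which for an invertible P containing I is P⁻¹ I without fractions.
  residual : Ideal R → Ideal R → Ideal R
  residual I P = record
    { member   = λ x → ∀ p → member P p → member I (p * x)
    ; member-≈ = λ x≈y f p p∈P → member-≈ (colon I p) x≈y (f p p∈P)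
    ; member-0 = λ p _ → member-0 (colon I p)
    ; member-+ = λ f g p p∈P → member-+ (colon I p) (f p p∈P) (g p p∈P)
    ; member-* = λ a f p p∈P → member-* (colon I p) a (f p p∈P) }

  adjoin : Ideal R → Carrier → Ideal R
  adjoin I a = record
    { member   = λ x → ∃[ r ] ∃[ m ] member I m × x ≈ m + r * a
    ; member-≈ = λ x≈y (r , m , m∈I , eq) → r , m , m∈I , ≈-trans (≈-sym x≈y) eq
    ; member-0 = 0# , 0# , member-0 I , ≈-sym (≈-trans (+-identityˡ _) (zeroˡ a))
    ; member-+ = λ (r , m , m∈I , eq) (s , n , n∈I , eq′) →
        r + s , m + n , member-+ I m∈I n∈I , (begin
          _                          ≈⟨ +-cong eq eq′ ⟩
          (m + r * a) + (n + s * a)  ≈⟨ interchange m (r * a) n (s * a) ⟩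
          (m + n) + (r * a + s * a)  ≈⟨ +-congˡ (distribʳ a r s) ⟨
          (m + n) + (r + s) * a      ∎)
    ; member-* = λ b (r , m , m∈I , eq) → b * r , b * m , member-* I b m∈I , (begin
          _                    ≈⟨ *-congˡ eq ⟩
          b * (m + r * a)      ≈⟨ distribˡ b m (r * a) ⟩
          b * m + b * (r * a)  ≈⟨ +-congˡ (*-assoc b r a) ⟨
          b * m + b * r * a    ∎) }
    where
    open import Algebra.Properties.CommutativeSemigroup
      (CommutativeMonoid.commutativeSemigroup +-commutativeMonoid) using (interchange)

  1∈⇒all : ∀ (I : Ideal R) → member I 1# → ∀ x → member I x
  1∈⇒all I 1∈I x = member-≈ I (*-identityʳ x) (member-* I x 1∈I)

  -- Otherwise M + (x) is a proper ideal containing M, hence equal to M, and x lies in M.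
  comaximal : ∀ {M} → IsMaximal R M → ∀ {x} → ¬ member M x →
              ∃[ r ] ∃[ m ] member M m × 1# ≈ m + r * x
  comaximal {M} M-max {x} x∉M = stable λ 1∉ → x∉M (proj₂
    (IsMaximal.maximal M-max (adjoin M x) 1∉
      (λ {m} m∈M → 0# , m , m∈M , ≈-sym (≈-trans (+-congˡ (zeroˡ x)) (+-identityʳ m))))
    (1# , 0# , member-0 M , ≈-sym (≈-trans (+-identityˡ _) (*-identityˡ x))))

  -- If x is outside M, multiply 1 = m + r x by y: both terms on the right lie in M.
  maximal⇒prime : ∀ {M} → IsMaximal R M → IsPrime R M
  maximal⇒prime {M} M-max = record { proper = IsMaximal.proper M-max ; prime = prime }
    where
    prime : ∀ x y → member M (x * y) → member M x ⊎ member M y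
    prime x y xy∈M with em {P = member M x}
    ... | yes x∈M = inj₁ x∈M
    ... | no x∉M with comaximal {M} M-max x∉M
    ...   | r , m , m∈M , 1≈ = inj₂ (member-≈ M (begin
      y * m + r * (x * y)  ≈⟨ +-cong (*-comm y m) (≈-sym (*-assoc r x y)) ⟩
      m * y + r * x * y    ≈⟨ distribʳ y m (r * x) ⟨
      (m + r * x) * y      ≈⟨ *-congʳ 1≈ ⟨
      1# * y               ≈⟨ *-identityˡ y ⟩
      y                    ∎)
      (member-+ M (member-* M y m∈M) (member-* M r xy∈M)))

  maximal-≋ : ∀ {M N} → IsMaximal R M → IsMaximal R N → member M ⊆ member N → _≋_ R M N
  maximal-≋ {N = N} M-max N-max = IsMaximal.maximal M-max N (IsMaximal.proper N-max)

-- Chains and maximal elements in Noetherian rings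

module Noetherian (em : Classical) {c ℓ} (R : CommutativeRing c ℓ)
                  (noetherian : IsNoetherian R) where
  open CommutativeRing R using (Carrier)
  open Logic em
  open Ideals em R
  open Ideal

  module _ (I : ℕ → Ideal R) (ascending : ∀ n → member (I n) ⊆ member (I (suc n))) where

    ascending-≤ : ∀ {m n} → m ℕ.≤ n → member (I m) ⊆ member (I n)
    ascending-≤ m≤n = go (ℕ.≤⇒≤′ m≤n)
      where
      go : ∀ {m n} → m ℕ.≤′ n → member (I m) ⊆ member (I n)
      go ℕ.≤′-refl       x∈ = x∈
      go (ℕ.≤′-step m≤n) x∈ = ascending _ (go m≤n x∈)

    union : Ideal R
    union = record
      { member   = λ x → ∃[ n ] member (I n) x
      ; member-≈ = λ x≈y (n , x∈) → n , member-≈ (I n) x≈y x∈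
      ; member-0 = 0 , member-0 (I 0)
      ; member-+ = λ (m , x∈) (n , y∈) → m ℕ.⊔ n , member-+ (I (m ℕ.⊔ n))
          (ascending-≤ (ℕ.m≤m⊔n m n) x∈) (ascending-≤ (ℕ.m≤n⊔m m n) y∈)
      ; member-* = λ a (n , x∈) → n , member-* (I n) a x∈ }

    bound : ∀ rs → (∀ {x} → x ∈ rs → member union x) → ∃[ N ] ∀ {x} → x ∈ rs → member (I N) x
    bound []       _   = 0 , λ ()
    bound (r ∷ rs) rs⊆ with rs⊆ (here refl) | bound rs (λ x∈rs → rs⊆ (there x∈rs))
    ... | m , r∈ | n , rs⊆Iₙ = m ℕ.⊔ n , λ where
      (here refl)   → ascending-≤ (ℕ.m≤m⊔n m n) r∈
      (there x∈rs)  → ascending-≤ (ℕ.m≤n⊔m m n) (rs⊆Iₙ x∈rs)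

    -- The union is finitely generated, and its finitely many generators already lie in a single
    -- `I N`.
    stabilizes : ∃[ N ] ∀ n → member (I n) ⊆ member (I N)
    stabilizes with noetherian union
    ... | rs , union⊆rs , rs⊆union with bound rs (λ x∈rs → rs⊆union (gen (lift x∈rs)))
    ...   | N , rs⊆ = N , λ n x∈ → span-least (I N) (λ (lift x∈rs) → rs⊆ x∈rs) (union⊆rs (n , x∈))

  IsMaximalIn : ∀ {s} → Pred (Ideal R) s → Pred (Ideal R) _
  IsMaximalIn S J = S J × (∀ J′ → S J′ → member J ⊆ member J′ → member J′ ⊆ member J)

  -- If no member of `S` were maximal, choosing a strictly larger one again and again would give a
  -- chain from `I` that never stabilizes.
  maximal-element : ∀ {s} (S : Pred (Ideal R) s) I → S I → ∃[ J ] IsMaximalIn S J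
  maximal-element S I I∈S = stable contradict
    where
    contradict : ¬ ¬ (∃[ J ] IsMaximalIn S J)
    contradict no-max = proj₂ (proj₂ (proj₂ (step (chain N)))) (stable-N (suc N))
      where
      step : (J : Σ[ J ∈ Ideal R ] S J) → Σ[ J′ ∈ Ideal R ] S J′ ×
             member (proj₁ J) ⊆ member J′ × ¬ member J′ ⊆ member (proj₁ J)
      step (J , J∈S) = stable λ no-step → no-max (J , J∈S , λ J′ J′∈S J⊆J′ →
        stable λ J′⊈J → no-step (J′ , J′∈S , (λ {x} → J⊆J′ {x}) , λ J′⊆J → J′⊈J λ {x} → J′⊆J {x}))

      chain : ℕ → Σ[ J ∈ Ideal R ] S J
      chain zero    = I , I∈S
      chain (suc n) = let J , J∈S , _ = step (chain n) in J , J∈S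

      ideals : ℕ → Ideal R
      ideals n = proj₁ (chain n)

      stable-exists : ∃[ N ] ∀ n → member (ideals n) ⊆ member (ideals N)
      stable-exists = stabilizes ideals (λ n → proj₁ (proj₂ (proj₂ (step (chain n)))))

      N = proj₁ stable-exists
      stable-N = proj₂ stable-exists

-- Ideals of linear combinations

module LinearCombinations {c ℓ} (R : CommutativeRing c ℓ) where
  open CommutativeRing R renaming (refl to ≈-refl; sym to ≈-sym; trans to ≈-trans)
  open Ideal
  open import Algebra.Properties.Semiring.Sum semiring
  open import Relation.Binary.Reasoning.Setoid setoid

  -- The ideal generated by the first n terms of `y`, with the coefficients kept as a function on
  -- `Fin n`: they become the coefficients of an integral equation.
  combinations : (ℕ → Carrier) → ℕ → Ideal R
  combinations y n = record
    { member   = λ x → Σ[ a ∈ (Fin n → Carrier) ] x ≈ ∑[ i < n ] (a i * y (toℕ i))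
    ; member-≈ = λ x≈x′ (a , eq) → a , ≈-trans (≈-sym x≈x′) eq
    ; member-0 = (λ _ → 0#) , (begin
        0#                                ≈⟨ zeroˡ _ ⟨
        0# * ∑[ i < n ] (y (toℕ i))       ≈⟨ *-distribˡ-sum {n} 0# _ ⟩
        ∑[ i < n ] (0# * y (toℕ i))       ∎)
    ; member-+ = λ (a , eq) (b , eq′) → (λ i → a i + b i) , (begin
        _
          ≈⟨ +-cong eq eq′ ⟩
        ∑[ i < n ] (a i * y (toℕ i)) + ∑[ i < n ] (b i * y (toℕ i))
          ≈⟨ ∑-distrib-+ {n} _ _ ⟨
        ∑[ i < n ] (a i * y (toℕ i) + b i * y (toℕ i))
          ≈⟨ sum-cong-≋ {n} (λ i → distribʳ _ (a i) (b i)) ⟨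
        ∑[ i < n ] ((a i + b i) * y (toℕ i))
          ∎)
    ; member-* = λ r (a , eq) → (λ i → r * a i) , (begin
        _                                   ≈⟨ *-congˡ eq ⟩
        r * ∑[ i < n ] (a i * y (toℕ i))    ≈⟨ *-distribˡ-sum {n} r _ ⟩
        ∑[ i < n ] (r * (a i * y (toℕ i)))  ≈⟨ sum-cong-≋ {n} (λ i → *-assoc r (a i) _) ⟨
        ∑[ i < n ] (r * a i * y (toℕ i))    ∎) }

  -- Sums unfold at their first index whereas the added term is the last, hence the recursion on the
  -- shifted sequence `y ∘ suc`.
  combinations-⊆-suc : ∀ y n → member (combinations y n) ⊆ member (combinations y (suc n))
  combinations-⊆-suc y zero    {x} (a , x≈0) = (λ _ → 0#) ,
    ≈-trans x≈0 (≈-sym (≈-trans (+-identityʳ _) (zeroˡ _)))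
  combinations-⊆-suc y (suc n) (a , eq) =
    let b , eq′ = combinations-⊆-suc (y ∘ suc) n (Vector.tail a , ≈-refl)
    in Vector.head a Vector.∷ b , ≈-trans eq (+-congˡ eq′)

  y∈combinations : ∀ y n → member (combinations y (suc n)) (y n)
  y∈combinations y zero    = (λ _ → 1#) , ≈-sym (≈-trans (+-identityʳ _) (*-identityˡ _))
  y∈combinations y (suc n) =
    let b , eq = y∈combinations (y ∘ suc) n
    in 0# Vector.∷ b , ≈-trans eq (≈-sym (≈-trans (+-congʳ (zeroˡ _)) (+-identityˡ _)))

-- Cancellation in domains and fields

module DomainCancellation {c ℓ} (R : CommutativeRing c ℓ) (domain : IsIntegralDomain R) where
  open CommutativeRing R renaming (refl to ≈-refl; sym to ≈-sym; trans to ≈-trans)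
  open import Algebra.Properties.Ring ring
  open IsIntegralDomain domain

  *-cancelˡ-nonzero : ∀ {a x y} → ¬ a ≈ 0# → a * x ≈ a * y → x ≈ y
  *-cancelˡ-nonzero {a} {x} {y} a≉0 ax≈ay with zero-product a (x - y)
    (≈-trans (x[y-z]≈xy-xz a x y) (≈-trans (+-congʳ ax≈ay) (-‿inverseʳ (a * y))))
  ... | inj₁ a≈0   = ⊥-elim (a≉0 a≈0)
  ... | inj₂ x-y≈0 = x∙y⁻¹≈ε⇒x≈y x y x-y≈0

  *-cancelʳ-nonzero : ∀ {a x y} → ¬ a ≈ 0# → x * a ≈ y * a → x ≈ y
  *-cancelʳ-nonzero a≉0 xa≈ya =
    *-cancelˡ-nonzero a≉0 (≈-trans (*-comm _ _) (≈-trans xa≈ya (*-comm _ _)))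

  *-nonzero : ∀ {a b} → ¬ a ≈ 0# → ¬ b ≈ 0# → ¬ a * b ≈ 0#
  *-nonzero {a} {b} a≉0 b≉0 ab≈0 with zero-product a b ab≈0
  ... | inj₁ a≈0 = a≉0 a≈0
  ... | inj₂ b≈0 = b≉0 b≈0

field⇒domain : Classical → ∀ {c ℓ} {A : CommutativeRing c ℓ} → IsField A → IsIntegralDomain A
field⇒domain em {A = A} isField = record { 1≉0 = 1≉0 ; zero-product = zero-product }
  where
  open CommutativeRing A renaming (refl to ≈-refl; sym to ≈-sym; trans to ≈-trans)
  open IsField isField
  open import Relation.Binary.Reasoning.Setoid setoid

  zero-product : ∀ x y → x * y ≈ 0# → x ≈ 0# ⊎ y ≈ 0#
  zero-product x y xy≈0 with em {P = x ≈ 0#}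
  ... | yes x≈0 = inj₁ x≈0
  ... | no x≉0  = let x⁻¹ , xx⁻¹≈1 = inverse x x≉0 in inj₂ (begin
    y              ≈⟨ *-identityʳ y ⟨
    y * 1#         ≈⟨ *-congˡ xx⁻¹≈1 ⟨
    y * (x * x⁻¹)  ≈⟨ *-assoc y x x⁻¹ ⟨
    y * x * x⁻¹    ≈⟨ *-congʳ (≈-trans (*-comm y x) xy≈0) ⟩
    0# * x⁻¹       ≈⟨ zeroˡ x⁻¹ ⟩
    0#             ∎)

-- The embedding into the field of fractions

module Embedding {c ℓ k ℓₖ} (R : CommutativeRing c ℓ) (F : FractionField R k ℓₖ) where
  private module R = CommutativeRing R
  open FractionField F
  private module K = Field K
  open IsRingMonomorphism ι-monomorphism
  open import Algebra.Properties.Semiring.Sum R.semiring using () renaming (sum to sumᴿ)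
  open import Algebra.Properties.Semiring.Sum K.semiring using (sum)

  ι-nonzero : ∀ {a} → ¬ a R.≈ R.0# → ¬ ι a K.≈ K.0#
  ι-nonzero a≉0 ιa≈0 = a≉0 (injective (K.trans ιa≈0 (K.sym 0#-homo)))

  ι-sum : ∀ {n} (f : Fin n → R.Carrier) → ι (sumᴿ f) K.≈ sum (λ i → ι (f i))
  ι-sum {zero}  f = 0#-homo
  ι-sum {suc n} f = K.trans (+-homo _ _) (K.+-congˡ (ι-sum (f ∘ suc)))

-- Dedekind domains: quotients stabilizing an ideal

module Dedekind (em : Classical) {c ℓ k ℓₖ} (R : CommutativeRing c ℓ) (F : FractionField R k ℓₖ)
                (dedekind : IsDedekindDomain R F) where
  open CommutativeRing R renaming (refl to ≈-refl; sym to ≈-sym; trans to ≈-trans)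
  open IsDedekindDomain dedekind
  open Ideal
  open Logic em
  open Ideals em R
  open Noetherian em R isNoetherian
  open DomainCancellation R isIntegralDomain

  module _ (I : Ideal R) (I≉0 : IsNonzero R I) {a b : Carrier} (a≉0 : ¬ a ≈ 0#)
           (bI⊆aI : ∀ x → member I x → ∃[ y ] member I y × b * x ≈ a * y) where
    private module K = Field (FractionField.K F)
    open FractionField F using (ι; ι-monomorphism)
    open IsRingMonomorphism ι-monomorphism
    open Embedding R F
    open DomainCancellation K.commutativeRing (field⇒domain em K.isField)
      using () renaming (*-cancelˡ-nonzero to *-cancelˡ-nonzeroᴷ)
    open LinearCombinations R
    open import Algebra.Properties.Semiring.Sum K.semiring
    open import Algebra.Properties.Semiring.Exp K.semiring using (_^_)
    open import Algebra.Properties.CommutativeSemigroup K.*-commutativeSemigroup using (x∙yz≈y∙xz)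
    open import Algebra.Properties.Ring ring using (-1*x≈-x)
    open import Relation.Binary.Reasoning.Setoid K.setoid

    private
      ιa≉0 = ι-nonzero a≉0
      d    = proj₁ I≉0
      ιd≉0 = ι-nonzero (proj₂ (proj₂ I≉0))

      a⁻¹ : K.Carrier
      a⁻¹ = proj₁ (K.inverse (ι a) ιa≉0)

      X : K.Carrier
      X = ι b K.* a⁻¹

      aX≈b : ι a K.* X K.≈ ι b
      aX≈b = K.trans (x∙yz≈y∙xz (ι a) (ι b) a⁻¹)
        (K.trans (K.*-congˡ (proj₂ (K.inverse (ι a) ιa≉0))) (K.*-identityʳ (ι b)))

      -- Iterates of multiplication by b / a, starting at `d`; they stay in I, so no denominators
      -- ever appear.
      orbit : ℕ → Σ[ x ∈ Carrier ] member I x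
      orbit zero    = d , proj₁ (proj₂ I≉0)
      orbit (suc n) = let x , x∈I = orbit n ; y , y∈I , _ = bI⊆aI x x∈I in y , y∈I

      y : ℕ → Carrier
      y n = proj₁ (orbit n)

      ιy : ∀ n → ι (y n) K.≈ ι d K.* X ^ n
      ιy zero    = K.sym (K.*-identityʳ (ι d))
      ιy (suc n) = *-cancelˡ-nonzeroᴷ ιa≉0 (begin
        ι a K.* ι (y (suc n))              ≈⟨ *-homo a (y (suc n)) ⟨
        ι (a * y (suc n))                  ≈⟨ ⟦⟧-cong (proj₂ (proj₂ (bI⊆aI (y n) (proj₂ (orbit n))))) ⟨
        ι (b * y n)                        ≈⟨ *-homo b (y n) ⟩
        ι b K.* ι (y n)                    ≈⟨ K.*-cong (K.sym aX≈b) (ιy n) ⟩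
        (ι a K.* X) K.* (ι d K.* X ^ n)    ≈⟨ K.*-assoc (ι a) X _ ⟩
        ι a K.* (X K.* (ι d K.* X ^ n))    ≈⟨ K.*-congˡ (x∙yz≈y∙xz X (ι d) (X ^ n)) ⟩
        ι a K.* (ι d K.* X ^ suc n)        ∎)

      -- Some `y N` is a combination of the earlier terms, because the ideals these generate
      -- stabilize. As `y n` is d Xⁿ, cancelling d leaves a monic equation for X.
      X-integral : IsIntegral R F X
      X-integral with stabilizes (combinations y) (combinations-⊆-suc y)
      -- Scaling by -1 makes the coefficients `r` those of the monic polynomial itself, with no
      -- change of sign.
      ... | N , ⊆N with member-* (combinations y N) (- 1#) (⊆N (suc N) (y∈combinations y N))
      ...   | r , -y≈∑ = N , r , *-cancelˡ-nonzeroᴷ ιd≉0 (begin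
        ι d K.* (X ^ N K.+ ∑[ i < N ] (ι (r i) K.* X ^ toℕ i))
          ≈⟨ K.distribˡ (ι d) _ _ ⟩
        ι d K.* X ^ N K.+ ι d K.* ∑[ i < N ] (ι (r i) K.* X ^ toℕ i)
          ≈⟨ K.+-congˡ (*-distribˡ-sum {N} (ι d) _) ⟩
        ι d K.* X ^ N K.+ ∑[ i < N ] (ι d K.* (ι (r i) K.* X ^ toℕ i))
          ≈⟨ K.+-cong (ιy N) (K.trans (ι-sum {N} _) (sum-cong-≋ {N} (λ i → K.trans (*-homo (r i) (y (toℕ i)))
               (K.trans (K.*-congˡ (ιy (toℕ i))) (x∙yz≈y∙xz (ι (r i)) (ι d) (X ^ toℕ i)))))) ⟨
        ι (y N) K.+ ι (sumᴿ (λ i → r i * y (toℕ i)))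
          ≈⟨ +-homo _ _ ⟨
        ι (y N + sumᴿ (λ i → r i * y (toℕ i)))
          ≈⟨ ⟦⟧-cong (≈-trans (+-congˡ (≈-trans (≈-sym -y≈∑) (-1*x≈-x (y N)))) (-‿inverseʳ (y N))) ⟩
        ι 0#            ≈⟨ 0#-homo ⟩
        K.0#            ≈⟨ K.zeroʳ (ι d) ⟨
        ι d K.* K.0#    ∎)
        where
        open import Algebra.Properties.Semiring.Sum semiring using () renaming (sum to sumᴿ)

    -- b / a is integral, since multiplication by it preserves a nonzero ideal
    -- and R is Noetherian.
    stable-quotient : ∃[ r ] b ≈ r * a
    stable-quotient with isIntegrallyClosed X X-integral
    ... | r , X≈ιr = r , injective (begin
      ι b            ≈⟨ aX≈b ⟨
      ι a K.* X      ≈⟨ K.*-congˡ X≈ιr ⟩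
      ι a K.* ι r    ≈⟨ K.*-comm (ι a) (ι r) ⟩
      ι r K.* ι a    ≈⟨ *-homo r a ⟨
      ι (r * a)      ∎)

  -- Invertibility of maximal ideals

  open import Algebra.Properties.CommutativeSemigroup *-commutativeSemigroup
    using (x∙yz≈y∙xz; xy∙z≈xz∙y; xy∙z≈y∙xz; interchange)
  open import Relation.Binary.Reasoning.Setoid setoid

  -- For nonzero a, the ideal of denominators of b / a: the x for which (b / a) x lies in R.
  [_∶_] : Carrier → Carrier → Ideal R
  [ a ∶ b ] = colon (multiples a) b

  [∶]-* : ∀ {a} b x {y} → member [ a ∶ b ] (x * y) → member [ a ∶ b * x ] y
  [∶]-* {a} b x {y} = member-≈ (multiples a) (≈-sym (*-assoc b x y))

  [∶]-swap : ∀ {a} b x {y} → member [ a ∶ b * x ] y → member [ a ∶ b ] (y * x)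
  [∶]-swap {a} b x {y} = member-≈ (multiples a) (≈-trans (*-assoc b x y) (*-congˡ (*-comm x y)))

  -- An ideal Q = (a : b) maximal among those contained in P is prime: if xy ∈ Q
  -- but x, y ∉ Q, then (a : bx) ⊈ P contains some t ∉ P, so x ∈ (a : bt) ⊈ P
  -- contains some s ∉ P, whence st ∈ Q ⊆ P.
  module _ {P : Ideal R} (P-prime : IsPrime R P) {a b : Carrier}
           (Q⊆P : member [ a ∶ b ] ⊆ member P)
           (largest : ∀ x → member [ a ∶ b * x ] ⊆ member P → member [ a ∶ b * x ] ⊆ member [ a ∶ b ]) where
    private module P = IsPrime P-prime

    [∶]-escape : ∀ {x y} → member [ a ∶ b ] (x * y) → ¬ member [ a ∶ b ] y →
                 ∃[ t ] member [ a ∶ b * x ] t × ¬ member P t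
    [∶]-escape {x} xy∈Q y∉Q = ⊈⇒∃ λ ⊆P → y∉Q (largest x ⊆P ([∶]-* b x xy∈Q))

    [∶]-prime : IsPrime R [ a ∶ b ]
    [∶]-prime = record { proper = P.proper ∘ Q⊆P ; prime = prime }
      where
      prime : ∀ x y → member [ a ∶ b ] (x * y) → member [ a ∶ b ] x ⊎ member [ a ∶ b ] y
      prime x y xy∈Q with em {P = member [ a ∶ b ] x} | em {P = member [ a ∶ b ] y}
      ... | yes x∈Q | _       = inj₁ x∈Q
      ... | no _    | yes y∈Q = inj₂ y∈Q
      ... | no x∉Q  | no y∉Q with [∶]-escape {x} {y} xy∈Q y∉Q
      ...   | t , t∈ , t∉P with [∶]-escape {t} {x} ([∶]-swap b x t∈) x∉Q
      ...     | s , s∈ , s∉P = ⊥-elim ([ s∉P , t∉P ]′ (P.prime s t (Q⊆P ([∶]-swap b t s∈))))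

  -- Among the (a : b) inside P, of which (a : 1) = (a) is one, take a maximal one. It is prime and
  -- contains a ≠ 0, so it is a maximal ideal and equals P. If b were in (a), it would contain 1.
  associated : ∀ {P a} → IsMaximal R P → ¬ a ≈ 0# → member P a →
    ∃[ b ] ¬ member (multiples a) b × (∀ x → member P x → member (multiples a) (b * x))
  associated {P} {a} P-max a≉0 a∈P
    with maximal-element (λ Q → ∃[ b ] _≋_ R Q [ a ∶ b ] × member Q ⊆ member P) [ a ∶ 1# ]
           (1# , ((λ x → x) , (λ x → x)) , λ (q , 1x≈qa) →
             member-≈ P (≈-trans (≈-sym 1x≈qa) (*-identityˡ _)) (member-* P q a∈P))
  ... | Q , (b , (Q⊆ , ⊆Q) , Q⊆P) , Q-largest = b , b∉a , λ x x∈P → P⊆Q x∈P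
    where
    largest : ∀ x → member [ a ∶ b * x ] ⊆ member P → member [ a ∶ b * x ] ⊆ member [ a ∶ b ]
    largest x ⊆P y∈ = Q⊆ (Q-largest [ a ∶ b * x ]
      (b * x , ((λ x → x) , (λ x → x)) , λ {y} → ⊆P {y})
      (λ {y} y∈Q → [∶]-* b x {y} (member-* [ a ∶ b ] x (Q⊆ y∈Q))) y∈)

    [∶]⊆P : member [ a ∶ b ] ⊆ member P
    [∶]⊆P x∈ = Q⊆P (⊆Q x∈)

    P⊆Q : member P ⊆ member [ a ∶ b ]
    P⊆Q = proj₂ (maximal-≋ {[ a ∶ b ]} {P}
      (prime⇒maximal [ a ∶ b ] (a , (b , ≈-refl) , a≉0)
        ([∶]-prime {P} (maximal⇒prime {P} P-max) {a} {b} [∶]⊆P largest))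
      P-max [∶]⊆P)

    b∉a : ¬ member (multiples a) b
    b∉a b∈a = IsMaximal.proper P-max ([∶]⊆P (member-≈ (multiples a) (≈-sym (*-identityʳ b)) b∈a))

  -- Invertibility of P without fractions: b / a lies in P⁻¹ but not in R, and
  -- its multiple (b / a) π is an element t of R outside P.
  record Inversion (P : Ideal R) : Set (c ⊔ ℓ) where
    field
      {a b π t} : Carrier
      a≉0   : ¬ a ≈ 0#
      b∉a   : ¬ member (multiples a) b
      bP⊆a  : ∀ x → member P x → ∃[ q ] b * x ≈ q * a
      π∈P   : member P π
      t∉P   : ¬ member P t
      bπ≈ta : b * π ≈ t * a

    -- As t = (b / a) π, t x is ((b / a) x) π, and (b / a) x is the cofactor given by `bP⊆a`. Thus π
    -- generates P up to the factor t outside P.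
    tP⊆π : ∀ x (x∈P : member P x) → t * x ≈ proj₁ (bP⊆a x x∈P) * π
    tP⊆π x x∈P with bP⊆a x x∈P
    ... | q , bx≈qa = *-cancelʳ-nonzero a≉0 (begin
      t * x * a    ≈⟨ xy∙z≈xz∙y t x a ⟩
      t * a * x    ≈⟨ *-congʳ bπ≈ta ⟨
      b * π * x    ≈⟨ xy∙z≈xz∙y b π x ⟩
      b * x * π    ≈⟨ *-congʳ bx≈qa ⟩
      q * a * π    ≈⟨ xy∙z≈xz∙y q a π ⟩
      q * π * a    ∎)

  -- If b / a mapped P into itself, `stable-quotient` would put b in (a). So some π in P is mapped
  -- outside P, and its image is t.
  invert : ∀ {P} → IsMaximal R P → IsNonzero R P → Inversion P
  invert {P} P-max P≉0@(a , a∈P , a≉0) = record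
    { a≉0 = a≉0 ; b∉a = b∉a ; bP⊆a = bP⊆a ; π∈P = π∈P ; t∉P = t∉P ; bπ≈ta = proj₂ (bP⊆a π π∈P) }
    where
    assoc = associated {P} {a} P-max a≉0 a∈P
    b    = proj₁ assoc
    b∉a  = proj₁ (proj₂ assoc)
    bP⊆a = proj₂ (proj₂ assoc)

    unstable : ∃[ x ] Σ[ x∈P ∈ member P x ] ¬ member P (proj₁ (bP⊆a x x∈P))
    unstable = stable λ none → b∉a (stable-quotient P P≉0 a≉0 λ x x∈P →
      let q , bx≈qa = bP⊆a x x∈P
      in q , stable (λ q∉P → none (x , x∈P , q∉P)) , ≈-trans bx≈qa (*-comm q a))

    π   = proj₁ unstable
    π∈P = proj₁ (proj₂ unstable)
    t∉P = proj₂ (proj₂ unstable)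

  -- Factorization into maximal ideals

  ⊗⊆ : ∀ (I J L : Ideal R) → (∀ {x y} → member I x → member J y → member L (x * y)) →
       member (_⊗_ R I J) ⊆ member L
  ⊗⊆ I J L f = span-least L λ (x , y , x∈I , y∈J , eq) → member-≈ L (≈-sym eq) (f x∈I y∈J)

  I⊆residual : ∀ (I P : Ideal R) → member I ⊆ member (residual I P)
  I⊆residual I P x∈I p _ = member-* I p x∈I

  module _ {P I : Ideal R} (P-max : IsMaximal R P) (inversion : Inversion P)
           (I≉0 : IsNonzero R I) (I⊆P : member I ⊆ member P) where
    open Inversion inversion
    private
      J : Ideal R
      J = residual I P

      -- With q = (b / a) x and r = (b / a) p, both in R, p q equals r x, which is in I.
      quotient∈J : ∀ x (x∈I : member I x) → member J (proj₁ (bP⊆a x (I⊆P x∈I)))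
      quotient∈J x x∈I p p∈P with bP⊆a x (I⊆P x∈I) | bP⊆a p p∈P
      ... | q , bx≈qa | r , bp≈ra = member-≈ I
        (*-cancelʳ-nonzero a≉0 (begin
          r * x * a    ≈⟨ xy∙z≈xz∙y r x a ⟩
          r * a * x    ≈⟨ *-congʳ bp≈ra ⟨
          b * p * x    ≈⟨ xy∙z≈y∙xz b p x ⟩
          p * (b * x)  ≈⟨ *-congˡ bx≈qa ⟩
          p * (q * a)  ≈⟨ *-assoc p q a ⟨
          p * q * a    ∎))
        (member-* I r x∈I)

    -- The quotients (b / a) x with x in I lie in (I : P); were this inside I, b / a would preserve
    -- I and b would be in (a). This strict growth drives the Noetherian induction.
    residual⊈I : ¬ member (residual I P) ⊆ member I
    residual⊈I J⊆I = b∉a (stable-quotient I I≉0 a≉0 λ x x∈I →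
      let q , bx≈qa = bP⊆a x (I⊆P x∈I) in q , J⊆I (quotient∈J x x∈I) , ≈-trans bx≈qa (*-comm q a))

    -- Write 1 = m + r t with m in P. In x = m x + r (t x), the first term is in P I, hence in P (I
    -- : P), and t x is π times an element of (I : P).
    factor : _≋_ R I (_⊗_ R P (residual I P))
    factor = I⊆PJ , ⊗⊆ P J I (λ {x} x∈P y∈J → y∈J x x∈P)
      where
      I⊆PJ : member I ⊆ member (_⊗_ R P J)
      I⊆PJ {x} x∈I with comaximal {P} P-max t∉P
      ... | r , m , m∈P , 1≈ = span-≈ (begin
        m * x + r * (t * x)  ≈⟨ +-congˡ (*-assoc r t x) ⟨
        m * x + r * t * x    ≈⟨ distribʳ x m (r * t) ⟨
        (m + r * t) * x      ≈⟨ *-congʳ 1≈ ⟨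
        1# * x               ≈⟨ *-identityˡ x ⟩
        x                    ∎)
        (span-+ (gen (m , x , m∈P , I⊆residual I P x∈I , ≈-refl))
                (span-* r (gen (π , _ , π∈P , quotient∈J x x∈I ,
                  ≈-trans (tP⊆π x (I⊆P x∈I)) (*-comm _ π)))))

  ⊗-congʳ : ∀ (I : Ideal R) {J L : Ideal R} → member J ⊆ member L → member (_⊗_ R I J) ⊆ member (_⊗_ R I L)
  ⊗-congʳ I {J} {L} J⊆L = ⊗⊆ I J (_⊗_ R I L) λ x∈I y∈J → gen (_ , _ , x∈I , J⊆L y∈J , ≈-refl)

  -- Containment of `I` is part of the predicate, since `maximal-element` does not relate its result
  -- to the initial ideal.
  proper⇒⊆maximal : ∀ (I : Ideal R) → IsProper R I → ∃[ P ] IsMaximal R P × member I ⊆ member P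
  proper⇒⊆maximal I I-proper with maximal-element (λ J → IsProper R J × member I ⊆ member J) I (I-proper , λ x → x)
  ... | P , (P-proper , I⊆P) , P-largest = P , P-max , λ {x} → I⊆P {x}
    where
    P-max : IsMaximal R P
    P-max = record { proper = P-proper ; maximal = λ J J-proper P⊆J →
      (λ {x} → P⊆J {x}) , P-largest J (J-proper , λ {x} x∈I → P⊆J (I⊆P x∈I)) P⊆J }

  -- A maximal counterexample J is proper, since the unit ideal is the empty product, so it lies in
  -- some maximal P. Then (J : P) is strictly larger, hence factors, and J = P (J : P) does too.
  factorization : ∀ (I : Ideal R) → IsNonzero R I → ∃[ Ps ] All (IsMaximal R) Ps × _≋_ R I (product R Ps)
  factorization I I≉0 = stable λ unfactorable → contradict
    (maximal-element (λ J → IsNonzero R J × ¬ Factorable J) I (I≉0 , unfactorable))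
    where
    Factorable : Pred (Ideal R) _
    Factorable J = ∃[ Ps ] All (IsMaximal R) Ps × _≋_ R J (product R Ps)

    contradict : ¬ (∃[ J ] IsMaximalIn (λ J → IsNonzero R J × ¬ Factorable J) J)
    contradict (J , (J≉0@(x , x∈J , x≉0) , unfactorable) , J-largest) with em {P = member J 1#}
    ... | yes 1∈J = unfactorable ([] , [] ,
      (λ {x} _ → multiples⊆⟨⟩ 1# (x , ≈-sym (*-identityʳ x))) , (λ {x} _ → 1∈⇒all J 1∈J x))
    ... | no J-proper with proper⇒⊆maximal J J-proper
    ...   | P , P-max , J⊆P = residual⊈I {P} {J} P-max inversion J≉0 J⊆P
      (J-largest L ((x , I⊆residual J P x∈J , x≉0) , λ (Ps , Ps-max , L⊆ , ⊆L) → unfactorable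
        (P ∷ Ps , P-max ∷ Ps-max ,
         (λ x∈J → ⊗-congʳ P {L} {product R Ps} L⊆ (proj₁ J≋PL x∈J)) ,
         (λ x∈ → proj₂ J≋PL (⊗-congʳ P {product R Ps} {L} ⊆L x∈))))
        (I⊆residual J P))
      where
      L : Ideal R
      L = residual J P
      inversion : Inversion P
      inversion = invert {P} P-max (x , J⊆P x∈J , x≉0)
      J≋PL : _≋_ R J (_⊗_ R P L)
      J≋PL = factor {P} {J} P-max inversion J≉0 J⊆P

  -- Normal form of elements at 𝔪

  module Local {𝔪 : Ideal R} (𝔪-max : IsMaximal R 𝔪) (inversion : Inversion 𝔪) where
    open Inversion inversion renaming (π∈P to π∈𝔪; t∉P to t∉𝔪; tP⊆π to t𝔪⊆π)
    open import Algebra.Properties.Semiring.Exp semiring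

    𝔪-prime = maximal⇒prime {𝔪} 𝔪-max
    open IsPrime 𝔪-prime

    ∉𝔪-* : ∀ {x y} → ¬ member 𝔪 x → ¬ member 𝔪 y → ¬ member 𝔪 (x * y)
    ∉𝔪-* x∉ y∉ xy∈ = [ x∉ , y∉ ]′ (prime _ _ xy∈)

    ∉𝔪⇒≉0 : ∀ {x} → ¬ member 𝔪 x → ¬ x ≈ 0#
    ∉𝔪⇒≉0 x∉ x≈0 = x∉ (member-≈ 𝔪 (≈-sym x≈0) (member-0 𝔪))

    π≉0 : ¬ π ≈ 0#
    π≉0 π≈0 = *-nonzero (∉𝔪⇒≉0 t∉𝔪) a≉0 (≈-trans (≈-sym bπ≈ta) (≈-trans (*-congˡ π≈0) (zeroʳ b)))

    π^≉0 : ∀ n → ¬ π ^ n ≈ 0#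
    π^≉0 zero    = IsIntegralDomain.1≉0 isIntegralDomain
    π^≉0 (suc n) = *-nonzero π≉0 (π^≉0 n)

    ν : List (Ideal R) → ℕ
    ν = multiplicity em R 𝔪

    -- Each occurrence of 𝔪 contributes a factor t to `s` through t 𝔪 ⊆ (π); for the other factors
    -- it suffices that the colon ideal absorbs multiplication.
    product⊆π^ν : ∀ Ps → ∃[ s ] ¬ member 𝔪 s ×
      member (product R Ps) ⊆ member (colon (multiples (π ^ ν Ps)) s)
    product⊆π^ν []       = 1# , proper , λ {x} _ → 1# * x , ≈-sym (*-identityʳ _)
    product⊆π^ν (P ∷ Ps) with em {P = _≋_ R P 𝔪} | product⊆π^ν Ps
    ... | yes (P⊆𝔪 , _) | s , s∉ , Ps⊆ = t * s , ∉𝔪-* t∉𝔪 s∉ ,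
      ⊗⊆ P (product R Ps) (colon (multiples (π ^ suc (ν Ps))) (t * s)) λ {x} {y} x∈P y∈Ps →
        let q , sy≈qπ = Ps⊆ y∈Ps in _ , (begin
          t * s * (x * y)                ≈⟨ interchange t s x y ⟩
          t * x * (s * y)                ≈⟨ *-cong (t𝔪⊆π x (P⊆𝔪 x∈P)) sy≈qπ ⟩
          _ * π * (q * π ^ ν Ps)         ≈⟨ interchange _ π q (π ^ ν Ps) ⟩
          _ * q * π ^ suc (ν Ps)         ∎)
    ... | no _ | s , s∉ , Ps⊆ = s , s∉ ,
      ⊗⊆ P (product R Ps) (colon (multiples (π ^ ν Ps)) s) λ {x} {y} x∈P y∈Ps →
        member-* (colon (multiples (π ^ ν Ps)) s) x (Ps⊆ y∈Ps)

    -- Each occurrence of 𝔪 contributes π. Any other maximal ideal is not contained in 𝔪 and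
    -- contributes an element outside 𝔪 to `s`.
    π^ν∈product : ∀ {Ps} → All (IsMaximal R) Ps → ∃[ s ] ¬ member 𝔪 s × member (product R Ps) (s * π ^ ν Ps)
    π^ν∈product [] = 1# , proper , span-* 1# (gen (lift ≈-refl))
    π^ν∈product {P ∷ Ps} (P-max ∷ Ps-max) with em {P = _≋_ R P 𝔪} | π^ν∈product Ps-max
    ... | yes (_ , 𝔪⊆P) | s , s∉ , s∈ = s , s∉ ,
      gen (π , s * π ^ ν Ps , 𝔪⊆P π∈𝔪 , s∈ , x∙yz≈y∙xz s π (π ^ ν Ps))
    ... | no P≉𝔪 | s , s∉ , s∈ with ⊈⇒∃ {P = member P} {Q = member 𝔪} (λ P⊆𝔪 → P≉𝔪 (maximal-≋ {P} {𝔪} P-max 𝔪-max P⊆𝔪))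
    ...   | x , x∈P , x∉𝔪 = x * s , ∉𝔪-* x∉𝔪 s∉ , gen (x , s * π ^ ν Ps , x∈P , s∈ , *-assoc x s _)

    -- The two inclusions for the factorization of (r) give s r = u πⁿ and s′ πⁿ = v r. Cancelling
    -- πⁿ leaves v u = s s′, which is outside 𝔪, so u is too.
    exponent-spec : ∀ {r} → ¬ r ≈ 0# → ∃[ s ] ∃[ u ] ¬ member 𝔪 s × ¬ member 𝔪 u ×
                    s * r ≈ u * π ^ exponent em R 𝔪 r
    exponent-spec {r} r≉0 with em {P = Factorization em R r}
    -- A nonzero r has a factorization, so the default exponent 0 never occurs here.
    ... | no ¬fact = ⊥-elim (¬fact (factorization (⟨_⟩ R r) (r , gen (lift ≈-refl) , r≉0)))
    ... | yes (Ps , Ps-max , r⊆Ps , Ps⊆r) with product⊆π^ν Ps | π^ν∈product Ps-max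
    ...   | s , s∉ , Ps⊆π | s′ , s′∉ , π∈Ps with Ps⊆π (r⊆Ps (gen (lift ≈-refl))) | ⟨⟩⊆multiples r (Ps⊆r π∈Ps)
    ...     | u , sr≈uπ | v , s′π≈vr = s , u , s∉ , u∉ , sr≈uπ
      where
      u∉ : ¬ member 𝔪 u
      u∉ u∈ = ∉𝔪-* s∉ s′∉ (member-≈ 𝔪 (*-cancelʳ-nonzero (π^≉0 (ν Ps)) (begin
        v * u * π ^ ν Ps     ≈⟨ *-assoc v u _ ⟩
        v * (u * π ^ ν Ps)   ≈⟨ *-congˡ sr≈uπ ⟨
        v * (s * r)          ≈⟨ x∙yz≈y∙xz v s r ⟩
        s * (v * r)          ≈⟨ *-congˡ s′π≈vr ⟨
        s * (s′ * π ^ ν Ps)  ≈⟨ *-assoc s s′ _ ⟨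
        s * s′ * π ^ ν Ps    ∎))
        (member-* 𝔪 v u∈))

    -- If m < n, cancelling π^m exhibits u as a multiple of π, against u being outside 𝔪.
    π^-divides : ∀ {u w m n} → ¬ member 𝔪 u → u * π ^ m ≈ w * π ^ n → n ℕ.≤ m
    π^-divides {u} {w} {m} {n} u∉ eq with n ℕ.≤? m
    ... | yes n≤m = n≤m
    ... | no n≰m with ℕ.m≤n⇒∃[o]m+o≡n (ℕ.≰⇒> n≰m)
    -- Here n is `suc (m ℕ.+ d)`; the successor supplies the factor π that puts u in 𝔪.
    ...   | d , refl = ⊥-elim (u∉ (member-≈ 𝔪 (≈-sym u≈) (member-* 𝔪 (w * π ^ d) π∈𝔪)))
      where
      u≈ : u ≈ w * π ^ d * π
      u≈ = *-cancelʳ-nonzero (π^≉0 m) (begin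
        u * π ^ m                    ≈⟨ eq ⟩
        w * (π * π ^ (m ℕ.+ d))      ≈⟨ *-congˡ (*-congˡ (^-homo-* π m d)) ⟩
        w * (π * (π ^ m * π ^ d))    ≈⟨ solve 4 (λ w p x y → w :* (p :* (x :* y)) := w :* y :* p :* x)
                                          ≈-refl w π (π ^ m) (π ^ d) ⟩
        w * π ^ d * π * π ^ m        ∎)
        where
        open import Algebra.Solver.Ring.NaturalCoefficients.Default commutativeSemiring

-- Integers as differences of natural exponents

module IntegerExponents where
  open import Data.Integer.Solver
  open +-*-Solver

  exponents-+ : ∀ {g h m n m′ n′} → g ℤ.+ + m ≡ + n → h ℤ.+ + m′ ≡ + n′ →
                (g ℤ.+ h) ℤ.+ + (m ℕ.+ m′) ≡ + (n ℕ.+ n′)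
  exponents-+ {g} {h} {m} {n} {m′} {n′} p q = begin
    (g ℤ.+ h) ℤ.+ + (m ℕ.+ m′)       ≡⟨ cong (λ z → (g ℤ.+ h) ℤ.+ z) (ℤ.pos-+ m m′) ⟩
    (g ℤ.+ h) ℤ.+ (+ m ℤ.+ + m′)     ≡⟨ solve 4 (λ a b c d → (a :+ b) :+ (c :+ d) := (a :+ c) :+ (b :+ d))
                                          refl g h (+ m) (+ m′) ⟩
    (g ℤ.+ + m) ℤ.+ (h ℤ.+ + m′)     ≡⟨ cong₂ ℤ._+_ p q ⟩
    + n ℤ.+ + n′                     ≡⟨ ℤ.pos-+ n n′ ⟨
    + (n ℕ.+ n′)                     ∎
    where open ≡-Reasoning

  -- Makes the two cross terms of a sum of fractions carry the same power of π.
  exponents-cross : ∀ {h m n m′ n′} → h ℤ.+ + m ≡ + n → h ℤ.+ + m′ ≡ + n′ → m′ ℕ.+ n ≡ m ℕ.+ n′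
  exponents-cross {h} {m} {n} {m′} {n′} p q = ℤ.+-injective (begin
    + (m′ ℕ.+ n)               ≡⟨ ℤ.pos-+ m′ n ⟩
    + m′ ℤ.+ + n               ≡⟨ cong (λ z → + m′ ℤ.+ z) p ⟨
    + m′ ℤ.+ (h ℤ.+ + m)       ≡⟨ solve 3 (λ a b c → a :+ (b :+ c) := c :+ (b :+ a)) refl (+ m′) h (+ m) ⟩
    + m ℤ.+ (h ℤ.+ + m′)       ≡⟨ cong (λ z → + m ℤ.+ z) q ⟩
    + m ℤ.+ + n′               ≡⟨ ℤ.pos-+ m n′ ⟨
    + (m ℕ.+ n′)               ∎)
    where open ≡-Reasoning

  +-cancelʳ-≤ : ∀ {i j k} → i ℤ.+ k ℤ.≤ j ℤ.+ k → i ℤ.≤ j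
  +-cancelʳ-≤ {i} {j} {k} le = subst₂ ℤ._≤_ (i+k-k≡i i) (i+k-k≡i j) (ℤ.+-monoˡ-≤ (ℤ.- k) le)
    where
    i+k-k≡i : ∀ i → (i ℤ.+ k) ℤ.- k ≡ i
    i+k-k≡i i = solve 2 (λ a b → (a :+ b) :- b := a) refl i k

  -- The hypothesis is n - m ≤ n′ - m′ with the subtractions cleared, the form in which `π^-divides`
  -- compares powers.
  exponents-≤ : ∀ {g h m n m′ n′} → g ℤ.+ + m ≡ + n → h ℤ.+ + m′ ≡ + n′ →
                m′ ℕ.+ n ℕ.≤ m ℕ.+ n′ → g ℤ.≤ h
  exponents-≤ {g} {h} {m} {n} {m′} {n′} p q le = +-cancelʳ-≤ {k = + (m ℕ.+ m′)} (begin
    g ℤ.+ + (m ℕ.+ m′)         ≡⟨ cong (λ z → g ℤ.+ z) (ℤ.pos-+ m m′) ⟩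
    g ℤ.+ (+ m ℤ.+ + m′)       ≡⟨ solve 3 (λ a b c → a :+ (b :+ c) := c :+ (a :+ b)) refl g (+ m) (+ m′) ⟩
    + m′ ℤ.+ (g ℤ.+ + m)       ≡⟨ cong (λ z → + m′ ℤ.+ z) p ⟩
    + m′ ℤ.+ + n               ≡⟨ ℤ.pos-+ m′ n ⟨
    + (m′ ℕ.+ n)               ≤⟨ ℤ.+≤+ le ⟩
    + (m ℕ.+ n′)               ≡⟨ ℤ.pos-+ m n′ ⟩
    + m ℤ.+ + n′               ≡⟨ cong (λ z → + m ℤ.+ z) q ⟨
    + m ℤ.+ (h ℤ.+ + m′)       ≡⟨ solve 3 (λ a b c → a :+ (b :+ c) := b :+ (a :+ c)) refl (+ m) h (+ m′) ⟩
    h ℤ.+ (+ m ℤ.+ + m′)       ≡⟨ cong (λ z → h ℤ.+ z) (ℤ.pos-+ m m′) ⟨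
    h ℤ.+ + (m ℕ.+ m′)         ∎)
    where open ℤ.≤-Reasoning

  ≤⇒∃ : ∀ {g h} → g ℤ.≤ h → ∃[ d ] g ℤ.+ + d ≡ h
  ≤⇒∃ {g} {h} g≤h = ℤ.∣ h ℤ.- g ∣ , trans (cong (λ z → g ℤ.+ z) (ℤ.0≤i⇒+∣i∣≡i (ℤ.i≤j⇒0≤j-i g≤h)))
    (solve 2 (λ a b → a :+ (b :- a) := b) refl g h)

  exponents-shift : ∀ {g h m n d} → g ℤ.+ + m ≡ + n → g ℤ.+ + d ≡ h → h ℤ.+ + m ≡ + (n ℕ.+ d)
  exponents-shift {g} {m = m} {n} {d} p refl = begin
    (g ℤ.+ + d) ℤ.+ + m        ≡⟨ solve 3 (λ a b c → (a :+ b) :+ c := (a :+ c) :+ b) refl g (+ d) (+ m) ⟩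
    (g ℤ.+ + m) ℤ.+ + d        ≡⟨ cong (ℤ._+ + d) p ⟩
    + n ℤ.+ + d                ≡⟨ ℤ.pos-+ n d ⟨
    + (n ℕ.+ d)                ∎
    where open ≡-Reasoning

  exponents-difference : ∀ m n → ℤ.- (+ m ℤ.- + n) ℤ.+ + m ≡ + n
  exponents-difference m n = solve 2 (λ a b → :- (a :- b) :+ a := b) refl (+ m) (+ n)

  exponents-exist : ∀ g → ∃[ m ] ∃[ n ] g ℤ.+ + m ≡ + n
  exponents-exist (+ n)    = 0 , n , ℤ.+-identityʳ (+ n)
  exponents-exist -[1+ k ] = suc k , 0 , ℤ.+-inverseˡ (+ suc k)

-- Fractions in the field of fractions

module Quotients (em : Classical) {c ℓ k ℓₖ} (R : CommutativeRing c ℓ) (F : FractionField R k ℓₖ) where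
  open CommutativeRing R hiding (refl; sym; trans)
  open FractionField F
  private module K = Field K
  open IsRingMonomorphism ι-monomorphism
  open Embedding R F
  open import Relation.Binary.Reasoning.Setoid K.setoid
  open import Algebra.Solver.Ring.NaturalCoefficients.Default K.commutativeSemiring

  -- x = r / s with the denominator cleared, as in `fraction`; that s is nonzero is supplied
  -- separately where it matters.
  IsQuotient : K.Carrier → Carrier → Carrier → Set ℓₖ
  IsQuotient x r s = x K.* ι s K.≈ ι r

  quotient-≈ : ∀ {x x′ r r′ s s′} → x K.≈ x′ → r ≈ r′ → s ≈ s′ → IsQuotient x r s → IsQuotient x′ r′ s′
  quotient-≈ x≈ r≈ s≈ q = K.trans (K.*-cong (K.sym x≈) (K.sym (⟦⟧-cong s≈))) (K.trans q (⟦⟧-cong r≈))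

  quotient-scale : ∀ {x r s} u → IsQuotient x r s → IsQuotient x (r * u) (s * u)
  quotient-scale {x} {r} {s} u q = begin
    x K.* ι (s * u)        ≈⟨ K.*-congˡ (*-homo s u) ⟩
    x K.* (ι s K.* ι u)    ≈⟨ K.*-assoc x (ι s) (ι u) ⟨
    x K.* ι s K.* ι u      ≈⟨ K.*-congʳ q ⟩
    ι r K.* ι u            ≈⟨ *-homo r u ⟨
    ι (r * u)              ∎

  quotient-* : ∀ {x y r s r′ s′} → IsQuotient x r s → IsQuotient y r′ s′ →
               IsQuotient (x K.* y) (r * r′) (s * s′)
  quotient-* {x} {y} {r} {s} {r′} {s′} p q = begin
    x K.* y K.* ι (s * s′)             ≈⟨ K.*-congˡ (*-homo s s′) ⟩
    x K.* y K.* (ι s K.* ι s′)         ≈⟨ solve 4 (λ a b c d → a :* b :* (c :* d) := a :* c :* (b :* d))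
                                            K.refl x y (ι s) (ι s′) ⟩
    x K.* ι s K.* (y K.* ι s′)         ≈⟨ K.*-cong p q ⟩
    ι r K.* ι r′                       ≈⟨ *-homo r r′ ⟨
    ι (r * r′)                         ∎

  quotient-+ : ∀ {x y r s r′ s′} → IsQuotient x r s → IsQuotient y r′ s′ →
               IsQuotient (x K.+ y) (r * s′ + r′ * s) (s * s′)
  quotient-+ {x} {y} {r} {s} {r′} {s′} p q = begin
    (x K.+ y) K.* ι (s * s′)                           ≈⟨ K.*-congˡ (*-homo s s′) ⟩
    (x K.+ y) K.* (ι s K.* ι s′)                       ≈⟨ solve 4 (λ a b c d →
                                                            (a :+ b) :* (c :* d) := a :* c :* d :+ b :* d :* c)
                                                            K.refl x y (ι s) (ι s′) ⟩
    x K.* ι s K.* ι s′ K.+ y K.* ι s′ K.* ι s          ≈⟨ K.+-cong (K.*-congʳ p) (K.*-congʳ q) ⟩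
    ι r K.* ι s′ K.+ ι r′ K.* ι s                      ≈⟨ K.+-cong (*-homo r s′) (*-homo r′ s) ⟨
    ι (r * s′) K.+ ι (r′ * s)                          ≈⟨ +-homo _ _ ⟨
    ι (r * s′ + r′ * s)                                ∎

  quotient-unique : ∀ {x r s r′ s′} → IsQuotient x r s → IsQuotient x r′ s′ → r * s′ ≈ r′ * s
  quotient-unique {x} {r} {s} {r′} {s′} p q = injective (begin
    ι (r * s′)              ≈⟨ *-homo r s′ ⟩
    ι r K.* ι s′            ≈⟨ K.*-congʳ p ⟨
    x K.* ι s K.* ι s′      ≈⟨ solve 3 (λ a b c → a :* b :* c := a :* c :* b) K.refl x (ι s) (ι s′) ⟩
    x K.* ι s′ K.* ι s      ≈⟨ K.*-congʳ q ⟩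
    ι r′ K.* ι s            ≈⟨ *-homo r′ s ⟨
    ι (r′ * s)              ∎)

  quotient-exists : ∀ r {s} → ¬ s ≈ 0# → ∃[ x ] IsQuotient x r s
  quotient-exists r {s} s≉0 = let s⁻¹ , ss⁻¹≈1 = K.inverse (ι s) (ι-nonzero s≉0) in
    ι r K.* s⁻¹ , (begin
      ι r K.* s⁻¹ K.* ι s      ≈⟨ K.*-assoc (ι r) s⁻¹ (ι s) ⟩
      ι r K.* (s⁻¹ K.* ι s)    ≈⟨ K.*-congˡ (K.trans (K.*-comm s⁻¹ (ι s)) ss⁻¹≈1) ⟩
      ι r K.* K.1#             ≈⟨ K.*-identityʳ (ι r) ⟩
      ι r                      ∎)

  quotient-≉0 : ∀ {x r s} → ¬ r ≈ 0# → IsQuotient x r s → ¬ x K.≈ K.0#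
  quotient-≉0 r≉0 q x≈0 = ι-nonzero r≉0 (K.trans (K.sym q) (K.trans (K.*-congʳ x≈0) (K.zeroˡ _)))

  numerator-≉0 : ∀ {x r s} → ¬ x K.≈ K.0# → ¬ s ≈ 0# → IsQuotient x r s → ¬ r ≈ 0#
  numerator-≉0 x≉0 s≉0 q r≈0 = *-nonzero x≉0 (ι-nonzero s≉0)
    (K.trans q (K.trans (⟦⟧-cong r≈0) 0#-homo))
    where open DomainCancellation K.commutativeRing (field⇒domain em K.isField)

-- The valuation laws for the 𝔪-adic valuation

module AdicValuation (em : Classical) {c ℓ k ℓₖ} (R : CommutativeRing c ℓ) (F : FractionField R k ℓₖ)
                     (dedekind : IsDedekindDomain R F)
                     {𝔪 : Ideal R} (𝔪-max : IsMaximal R 𝔪)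
                     (inversion : Dedekind.Inversion em R F dedekind 𝔪) where
  open CommutativeRing R renaming (refl to ≈-refl; sym to ≈-sym; trans to ≈-trans)
  open Ideal
  open FractionField F
  private module K = Field K
  open Dedekind em R F dedekind
  open Inversion inversion using (π)
  open Local 𝔪-max inversion
  open IsDedekindDomain dedekind using (isIntegralDomain)
  open DomainCancellation R isIntegralDomain
  open IntegerExponents
  open IsPrime 𝔪-prime using () renaming (proper to 1∉𝔪)
  open Quotients em R F
  open import Algebra.Properties.Semiring.Exp semiring
  open import Algebra.Solver.Ring.NaturalCoefficients.Default commutativeSemiring
  open import Relation.Binary.Reasoning.Setoid setoid

  -- Bound x g says v(x) ≤ g, and HasValue x g says v(x) = g; as v(π) = -1, the
  -- exponents of π enter g as n - m.
  record Bound (x : K.Carrier) (g : ℤ) : Set (c ⊔ ℓ ⊔ ℓₖ) where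
    field
      {m n}    : ℕ
      {r s}    : Carrier
      s∉𝔪      : ¬ member 𝔪 s
      quotient : IsQuotient x (r * π ^ m) (s * π ^ n)
      exps     : g ℤ.+ + m ≡ + n

  record HasValue (x : K.Carrier) (g : ℤ) : Set (c ⊔ ℓ ⊔ ℓₖ) where
    field
      bound : Bound x g
    open Bound bound public
    field
      r∉𝔪 : ¬ member 𝔪 r

  π-interchange : ∀ a m b n → (a * π ^ m) * (b * π ^ n) ≈ (a * b) * π ^ (m ℕ.+ n)
  π-interchange a m b n = begin
    (a * π ^ m) * (b * π ^ n)    ≈⟨ solve 4 (λ a p b q → a :* p :* (b :* q) := a :* b :* (p :* q))
                                      ≈-refl a (π ^ m) b (π ^ n) ⟩
    (a * b) * (π ^ m * π ^ n)    ≈⟨ *-congˡ (^-homo-* π m n) ⟨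
    (a * b) * π ^ (m ℕ.+ n)      ∎

  bound-≈ : ∀ {x y g} → x K.≈ y → Bound x g → Bound y g
  bound-≈ x≈y b = record { s∉𝔪 = s∉𝔪 ; quotient = quotient-≈ x≈y ≈-refl ≈-refl quotient ; exps = exps }
    where open Bound b

  -- Numerator and denominator are multiplied by π^d with d = h - g. Above, the power is absorbed
  -- into the unrestricted `r`, so only `n` grows.
  bound-mono : ∀ {x g h} → g ℤ.≤ h → Bound x g → Bound x h
  bound-mono {g = g} g≤h b with ≤⇒∃ g≤h
  ... | d , g+d≡h = record
    { m        = m
    ; r        = r * π ^ d
    ; s∉𝔪      = s∉𝔪
    ; quotient = quotient-≈ K.refl
        (solve 3 (λ a p q → a :* p :* q := a :* q :* p) ≈-refl r (π ^ m) (π ^ d))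
        (≈-trans (*-assoc s _ _) (*-congˡ (≈-sym (^-homo-* π n d))))
        (quotient-scale (π ^ d) quotient)
    ; exps     = exponents-shift {g} exps g+d≡h }
    where open Bound b

  -- The ultrametric inequality: as both bounds are the same g, the two terms over the common
  -- denominator share a power of π, which factors out.
  bound-+ : ∀ {x y g} → Bound x g → Bound y g → Bound (x K.+ y) g
  bound-+ {g = g} bx by = record
    { m        = x.m ℕ.+ y.n
    ; r        = x.r * y.s + y.r * x.s
    ; s∉𝔪      = ∉𝔪-* x.s∉𝔪 y.s∉𝔪
    ; quotient = quotient-≈ K.refl (begin
        (x.r * π ^ x.m) * (y.s * π ^ y.n) + (y.r * π ^ y.m) * (x.s * π ^ x.n)
          ≈⟨ +-cong (π-interchange x.r x.m y.s y.n) (π-interchange y.r y.m x.s x.n) ⟩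
        (x.r * y.s) * π ^ (x.m ℕ.+ y.n) + (y.r * x.s) * π ^ (y.m ℕ.+ x.n)
          ≈⟨ +-congˡ (*-congˡ (^-congʳ π (exponents-cross {g} x.exps y.exps))) ⟩
        (x.r * y.s) * π ^ (x.m ℕ.+ y.n) + (y.r * x.s) * π ^ (x.m ℕ.+ y.n)
          ≈⟨ distribʳ _ _ _ ⟨
        (x.r * y.s + y.r * x.s) * π ^ (x.m ℕ.+ y.n) ∎)
        (π-interchange x.s x.n y.s y.n)
        (quotient-+ x.quotient y.quotient)
    ; exps     = exponents-sum }
    where
    module x = Bound bx
    module y = Bound by
    exponents-sum : g ℤ.+ + (x.m ℕ.+ y.n) ≡ + (x.n ℕ.+ y.n)
    exponents-sum = trans (cong (λ z → g ℤ.+ z) (ℤ.pos-+ x.m y.n)) (trans (sym (ℤ.+-assoc g (+ x.m) (+ y.n)))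
      (trans (cong (ℤ._+ + y.n) x.exps) (sym (ℤ.pos-+ x.n y.n))))

  value-* : ∀ {x y g h} → HasValue x g → HasValue y h → HasValue (x K.* y) (g ℤ.+ h)
  value-* {g = g} {h} vx vy = record
    { bound = record
      { s∉𝔪      = ∉𝔪-* x.s∉𝔪 y.s∉𝔪
      ; quotient = quotient-≈ K.refl (π-interchange x.r x.m y.r y.m) (π-interchange x.s x.n y.s y.n)
                     (quotient-* x.quotient y.quotient)
      ; exps     = exponents-+ {g} {h} x.exps y.exps }
    ; r∉𝔪 = ∉𝔪-* x.r∉𝔪 y.r∉𝔪 }
    where
    module x = HasValue vx
    module y = HasValue vy

  value-≈ : ∀ {x y g} → x K.≈ y → HasValue x g → HasValue y g
  value-≈ x≈y vx = record { bound = bound-≈ x≈y bound ; r∉𝔪 = r∉𝔪 } where open HasValue vx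

  value-1 : HasValue K.1# 0ℤ
  value-1 = record
    { bound = record { m = 0 ; n = 0 ; r = 1# ; s = 1# ; s∉𝔪 = 1∉𝔪 ; quotient = K.*-identityˡ _ ; exps = refl }
    ; r∉𝔪 = 1∉𝔪 }

  -- The element is π^m / π^n with g = n - m, since π has value -1.
  value-exists : ∀ g → ∃[ x ] HasValue x g
  value-exists g with exponents-exist g
  ... | m , n , eq with quotient-exists (1# * π ^ m) {1# * π ^ n} (*-nonzero (∉𝔪⇒≉0 1∉𝔪) (π^≉0 n))
  ...   | x , q = x , record { bound = record { s∉𝔪 = 1∉𝔪 ; quotient = q ; exps = eq } ; r∉𝔪 = 1∉𝔪 }

  -- Cross-multiplying the two fractions for x leaves a coefficient outside 𝔪 on one side, so
  -- `π^-divides` applies. Used in both directions this makes values unique.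
  value≤bound : ∀ {x g h} → HasValue x g → Bound x h → g ℤ.≤ h
  value≤bound {g = g} {h} vx bx = exponents-≤ {g} {h} x.exps y.exps (π^-divides (∉𝔪-* x.r∉𝔪 y.s∉𝔪) (begin
    (x.r * y.s) * π ^ (x.m ℕ.+ y.n)      ≈⟨ π-interchange x.r x.m y.s y.n ⟨
    (x.r * π ^ x.m) * (y.s * π ^ y.n)    ≈⟨ quotient-unique x.quotient y.quotient ⟩
    (y.r * π ^ y.m) * (x.s * π ^ x.n)    ≈⟨ π-interchange y.r y.m x.s x.n ⟩
    (y.r * x.s) * π ^ (y.m ℕ.+ x.n)      ∎))
    where
    module x = HasValue vx
    module y = Bound bx

  value-≉0 : ∀ {x g} → HasValue x g → ¬ x K.≈ K.0#
  value-≉0 vx = quotient-≉0 (*-nonzero (∉𝔪⇒≉0 r∉𝔪) (π^≉0 m)) quotient where open HasValue vx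

  v : K.Carrier → ℤₘ₀
  v = adicValuation em R F 𝔪

  v-zero : ∀ {x} → x K.≈ K.0# → v x ≡ 0ₘ
  v-zero {x} x≈0 with em {P = x K.≈ K.0#}
  ... | yes _  = refl
  ... | no x≉0 = ⊥-elim (x≉0 x≈0)

  -- The chosen fraction r / s is expanded by t t′, where t r and t′ s are the normal forms from
  -- `exponent-spec`.
  v-nonzero : ∀ {x} → ¬ x K.≈ K.0# → ∃[ g ] v x ≡ ofAdd g × HasValue x g
  v-nonzero {x} x≉0 with em {P = x K.≈ K.0#}
  ... | yes x≈0 = ⊥-elim (x≉0 x≈0)
  ... | no _    = _ , refl , value
    where
    r   = proj₁ (fraction x)
    s   = proj₁ (proj₂ (fraction x))
    s≉0 = proj₁ (proj₂ (proj₂ (fraction x)))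
    q   = proj₂ (proj₂ (proj₂ (fraction x)))
    e   = exponent em R 𝔪

    value : HasValue x (ℤ.- (+ e r ℤ.- + e s))
    value with exponent-spec (numerator-≉0 x≉0 s≉0 q) | exponent-spec s≉0
    ... | t , u , t∉ , u∉ , tr≈uπ | t′ , u′ , t′∉ , u′∉ , t′s≈u′π = record
      { bound = record
        { r        = u * t′
        ; s∉𝔪      = ∉𝔪-* u′∉ t∉
        ; quotient = quotient-≈ K.refl
            (begin
              r * (t * t′)          ≈⟨ solve 3 (λ r t t′ → r :* (t :* t′) := t :* r :* t′) ≈-refl r t t′ ⟩
              t * r * t′            ≈⟨ *-congʳ tr≈uπ ⟩
              u * π ^ e r * t′      ≈⟨ solve 3 (λ r t t′ → r :* t :* t′ := r :* t′ :* t) ≈-refl u _ t′ ⟩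
              u * t′ * π ^ e r      ∎)
            (begin
              s * (t * t′)          ≈⟨ solve 3 (λ r t t′ → r :* (t :* t′) := t′ :* r :* t) ≈-refl s t t′ ⟩
              t′ * s * t            ≈⟨ *-congʳ t′s≈u′π ⟩
              u′ * π ^ e s * t      ≈⟨ solve 3 (λ r t t′ → r :* t :* t′ := r :* t′ :* t) ≈-refl u′ _ t ⟩
              u′ * t * π ^ e s      ∎)
            (quotient-scale (t * t′) q)
        ; exps     = exponents-difference (e r) (e s) }
      ; r∉𝔪 = ∉𝔪-* u∉ t′∉ }

  -- Frees `v` from the fraction chosen in its definition: any normal form of x computes it.
  v-value : ∀ {x g} → HasValue x g → v x ≡ ofAdd g
  v-value vx with v-nonzero (value-≉0 vx)
  ... | h , vx≡h , vx′ = trans vx≡h (cong ofAdd (ℤ.≤-antisym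
    (value≤bound vx′ (HasValue.bound vx)) (value≤bound vx (HasValue.bound vx′))))

  view : ∀ x → x K.≈ K.0# ⊎ (∃[ g ] v x ≡ ofAdd g × HasValue x g)
  view x = [ inj₁ , (λ x≉0 → inj₂ (v-nonzero x≉0)) ]′ (toSum em)

  v-cong : ∀ {x y} → x K.≈ y → v x ≡ v y
  v-cong {x} x≈y with view x
  ... | inj₁ x≈0             = trans (v-zero x≈0) (sym (v-zero (K.trans (K.sym x≈y) x≈0)))
  ... | inj₂ (g , vx≡g , vx) = trans vx≡g (sym (v-value (value-≈ x≈y vx)))

  v-* : ∀ x y → v (x K.* y) ≡ v x · v y
  v-* x y with view x | view y
  ... | inj₁ x≈0 | _ = trans (v-zero (K.trans (K.*-congʳ x≈0) (K.zeroˡ y)))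
    (cong (_· v y) (sym (v-zero x≈0)))
  ... | inj₂ (g , vx≡g , _) | inj₁ y≈0 = trans (v-zero (K.trans (K.*-congˡ y≈0) (K.zeroʳ x)))
    (sym (cong₂ _·_ vx≡g (v-zero y≈0)))
  ... | inj₂ (g , vx≡g , vx) | inj₂ (h , vy≡h , vy) =
    trans (v-value (value-* vx vy)) (sym (cong₂ _·_ vx≡g vy≡h))

  private module M = ℤₘ₀-Properties.M

  v-+ : ∀ x y → v (x K.+ y) ≤₋ max (v x) (v y)
  v-+ x y with view x | view y | view (x K.+ y)
  ... | inj₁ x≈0 | _ | _ = M.≤-trans
    (M.≤-reflexive (v-cong (K.trans (K.+-congʳ x≈0) (K.+-identityˡ y)))) (M.x≤y⊔x (v x) (v y))
  ... | inj₂ _ | inj₁ y≈0 | _ = M.≤-trans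
    (M.≤-reflexive (v-cong (K.trans (K.+-congˡ y≈0) (K.+-identityʳ x)))) (M.x≤x⊔y (v x) (v y))
  ... | inj₂ _ | inj₂ _ | inj₁ x+y≈0 = subst (_≤₋ max (v x) (v y)) (sym (v-zero x+y≈0)) (⊥₋≤ _)
  ... | inj₂ (g , vx≡g , vx) | inj₂ (h , vy≡h , vy) | inj₂ (i , vxy≡i , vxy) =
    subst (_≤₋ max (v x) (v y)) (sym vxy≡i)
      -- `bound-+` needs a common bound, so the smaller value is first raised to the larger.
      ([ (λ g≤h → M.≤-trans (i≤ (bound-mono g≤h bx) by) (subst (_≤₋ max (v x) (v y)) vy≡h (M.x≤y⊔x (v x) (v y))))
       , (λ h≤g → M.≤-trans (i≤ bx (bound-mono h≤g by)) (subst (_≤₋ max (v x) (v y)) vx≡g (M.x≤x⊔y (v x) (v y))))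
       ]′ (ℤ.≤-total g h))
    where
    bx = HasValue.bound vx
    by = HasValue.bound vy

    i≤ : ∀ {j} → Bound x j → Bound y j → ofAdd i ≤₋ ofAdd j
    i≤ p q = Inf.[ value≤bound vxy (bound-+ p q) ]

  v-isValuation : IsValuation K.commutativeRing v
  v-isValuation = record
    { v-cong = v-cong
    ; v-0    = v-zero K.refl
    ; v-1    = v-value value-1
    ; v-*    = v-*
    ; v-+    = v-+ }

  v-surjective : ∀ α → ∃[ x ] v x ≡ α
  v-surjective 0ₘ        = K.0# , v-zero K.refl
  v-surjective (ofAdd g) = let x , val = value-exists g in x , v-value val

-- The unit ball of a discretely valued field

module DiscreteValuationField (em : Classical) {c ℓ} {A : CommutativeRing c ℓ} (isField : IsField A)
                              (V : Valuation A) (discrete : IsDiscrete A V) where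
  open CommutativeRing A renaming (refl to ≈-refl; sym to ≈-sym; trans to ≈-trans)
  open IsField isField
  open Valuation V renaming (val to v)
  open Logic em
  open Ideal
  private
    module M = ℤₘ₀-Properties.M
    module B = CommutativeRing (unitBall A V)
    module BI = Ideals em (unitBall A V)

  0ₘ≢ofAdd : ∀ {g} → ¬ _≡_ {A = ℤₘ₀} 0ₘ (ofAdd g)
  0ₘ≢ofAdd ()

  v-unit : ∀ {x y} → x * y ≈ 1# → v x · v y ≡ 1ₘ
  v-unit xy≈1 = trans (sym (v-* _ _)) (trans (v-cong xy≈1) v-1)

  v-nonzero : ∀ {x} → ¬ x ≈ 0# → ∃[ g ] v x ≡ ofAdd g
  v-nonzero {x} x≉0 with v x in vx≡ | v-unit (proj₂ (inverse x x≉0))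
  ... | 0ₘ      | ()
  ... | ofAdd g | _ = g , refl

  v-≢0 : ∀ {x g} → v x ≡ ofAdd g → ¬ x ≈ 0#
  v-≢0 vx≡ x≈0 = 0ₘ≢ofAdd (trans (sym v-0) (trans (v-cong (≈-sym x≈0)) vx≡))

  v-inverse : ∀ {x y g} → v x ≡ ofAdd g → x * y ≈ 1# → v y ≡ ofAdd (ℤ.- g)
  v-inverse {y = y} {g} vx≡g xy≈1 =
    ℤₘ₀-Properties.·-inverse g (v y) (trans (cong (_· v y) (sym vx≡g)) (v-unit xy≈1))

  -- The field quotient y x⁻¹ has value at most `ofAdd (g - g)`, so divisibility in the ball is
  -- comparison of values.
  divide : ∀ {x y g} → v x ≡ ofAdd g → v y ≤₋ ofAdd g → ∃[ q ] v q ≤₋ 1ₘ × y ≈ q * x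
  divide {x} {y} {g} vx≡g vy≤g with inverse x (v-≢0 vx≡g)
  ... | x⁻¹ , xx⁻¹≈1 = y * x⁻¹ , vq≤1 , ≈-sym (≈-trans (*-assoc y x⁻¹ x)
    (≈-trans (*-congˡ (≈-trans (*-comm x⁻¹ x) xx⁻¹≈1)) (*-identityʳ y)))
    where
    vq≤1 : v (y * x⁻¹) ≤₋ 1ₘ
    vq≤1 = subst₂ _≤₋_ (sym (v-* y x⁻¹)) (cong ofAdd (ℤ.+-inverseʳ g))
      (ℤₘ₀-Properties.·-mono vy≤g (M.≤-reflexive (v-inverse vx≡g xx⁻¹≈1)))

  unitBall-isIntegralDomain : IsIntegralDomain (unitBall A V)
  unitBall-isIntegralDomain = record
    { 1≉0          = 1≉0
    ; zero-product = λ (x , _) (y , _) → IsIntegralDomain.zero-product (field⇒domain em isField) x y }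

  -- Nonzero elements of the ball have values `ofAdd (- n)` with n natural; counting by n turns a
  -- largest value into a least number.
  HasOrder : Ideal (unitBall A V) → Pred ℕ _
  HasOrder I n = ∃[ x ] member I x × v (proj₁ x) ≡ ofAdd (ℤ.- + n)

  ball-order : ∀ (x : B.Carrier) → ¬ proj₁ x ≈ 0# → ∃[ n ] v (proj₁ x) ≡ ofAdd (ℤ.- + n)
  ball-order (x , vx≤1) x≉0 with v-nonzero x≉0
  ... | g , vx≡g with subst (_≤₋ 1ₘ) vx≡g vx≤1
  ...   | Inf.[ g≤0 ] = ℤ.∣ ℤ.- g ∣ , trans vx≡g (cong ofAdd (trans (sym (ℤ.neg-involutive g))
    (cong ℤ.-_ (sym (ℤ.0≤i⇒+∣i∣≡i (ℤ.neg-mono-≤ g≤0))))))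

  -- Without a least element, strong induction refutes P everywhere.
  least : ∀ {p} {P : Pred ℕ p} n → P n → ∃[ m ] P m × (∀ n → P n → m ℕ.≤ n)
  least {P = P} n Pn = stable λ none → none-below none n Pn
    where
    none-below : ¬ (∃[ m ] P m × (∀ n → P n → m ℕ.≤ n)) → ∀ n → ¬ P n
    none-below none = <-rec (λ n → ¬ P n) λ n below Pn →
      none (n , Pn , λ m Pm → ℕ.≮⇒≥ λ m<n → below m<n Pm)

  -- A nonzero ideal is generated by any of its elements of maximal valuation.
  unitBall-principal : ∀ (I : Ideal (unitBall A V)) → ∃[ r ] _≋_ (unitBall A V) I (⟨_⟩ (unitBall A V) r)
  unitBall-principal I with em {P = ∃[ n ] HasOrder I n}
  ... | no all-zero = B.0# , I⊆0 , λ x∈ → BI.span-least I (λ (lift x≈0) → member-≈ I (≈-sym x≈0) (member-0 I)) x∈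
    where
    I⊆0 : member I ⊆ member (⟨_⟩ (unitBall A V) B.0#)
    I⊆0 {x} x∈I = gen (lift (stable λ x≉0 →
      let n , vx≡ = ball-order x x≉0 in all-zero (n , x , x∈I , vx≡)))
  ... | yes (n , I-n) with least {P = HasOrder I} n I-n
  ...   | m , (x , x∈I , vx≡) , m≤ = x , I⊆x , BI.span-least I (λ (lift y≈x) → member-≈ I (≈-sym y≈x) x∈I)
    where
    I⊆x : member I ⊆ member (⟨_⟩ (unitBall A V) x)
    I⊆x {y , vy≤1} y∈I with em {P = y ≈ 0#}
    ... | yes y≈0 = span-≈ (≈-sym y≈0) span-0
    ... | no y≉0 with ball-order (y , vy≤1) y≉0
    ...   | k , vy≡ with divide {g = ℤ.- + m} vx≡ (subst (_≤₋ ofAdd (ℤ.- + m)) (sym vy≡)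
              Inf.[ ℤ.neg-mono-≤ (ℤ.+≤+ (m≤ k ((y , vy≤1) , y∈I , vy≡))) ])
    ...     | q , vq≤1 , y≈qx = BI.multiples⊆⟨⟩ x ((q , vq≤1) , y≈qx)

  -- The open ball v(x) < 1, as `ofAdd ℤ.-1ℤ` is the largest value below `1ₘ`; `Lift` only adjusts
  -- the universe level.
  maximalIdeal : Ideal (unitBall A V)
  maximalIdeal = record
    { member   = λ x → Lift (c ⊔ ℓ) (v (proj₁ x) ≤₋ ofAdd ℤ.-1ℤ)
    ; member-≈ = λ x≈y (lift p) → lift (subst (_≤₋ _) (v-cong x≈y) p)
    ; member-0 = lift (subst (_≤₋ _) (sym v-0) (⊥₋≤ _))
    ; member-+ = λ (lift p) (lift q) → lift (Ultrametric.+-≤ A V p q)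
    ; member-* = λ (a , va≤1) (lift p) → lift (Ultrametric.*-≤ A V va≤1 p) }

  -- An element of value 1 divides 1, so a proper ideal has none. Both maximality and uniqueness of
  -- `maximalIdeal` follow.
  proper⊆maximalIdeal : ∀ J → IsProper (unitBall A V) J → member J ⊆ member maximalIdeal
  proper⊆maximalIdeal J J-proper {x , vx≤1} x∈J with ℤₘ₀-Properties._≤?_ 1ₘ (v x)
  ... | no 1≰vx = lift (ℤₘ₀-Properties.≤-pred 1≰vx)
  ... | yes 1≤vx with divide {g = 0ℤ} (M.antisym vx≤1 1≤vx) (M.≤-reflexive v-1)
  ...   | q , vq≤1 , 1≈qx = ⊥-elim (J-proper (member-≈ J (≈-sym 1≈qx) (member-* J (q , vq≤1) x∈J)))

  maximalIdeal-isMaximal : IsMaximal (unitBall A V) maximalIdeal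
  maximalIdeal-isMaximal = record
    { proper  = λ (lift p) → ℤₘ₀-Properties.ofAdd-≰ 0ℤ (subst (_≤₋ ofAdd ℤ.-1ℤ) v-1 p)
    ; maximal = λ J J-proper M⊆J → (λ {x} → M⊆J {x}) , λ {x} → proper⊆maximalIdeal J J-proper {x} }

  unitBall-isLocal : IsLocal (unitBall A V)
  unitBall-isLocal = maximalIdeal , maximalIdeal-isMaximal , λ N N-max →
    IsMaximal.maximal N-max maximalIdeal (IsMaximal.proper maximalIdeal-isMaximal)
      (λ {x} → proper⊆maximalIdeal N (IsMaximal.proper N-max) {x})

  -- Discreteness provides an element of value `ofAdd -1`; its inverse would have value `ofAdd 1`,
  -- outside the ball.
  unitBall-notField : ¬ IsField (unitBall A V)
  unitBall-notField ball-field with discrete (ofAdd ℤ.-1ℤ)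
  ... | x , surj = not-invertible (IsField.inverse ball-field (x , vx≤1) (v-≢0 vx≡-1))
    where
    vx≡-1 : v x ≡ ofAdd ℤ.-1ℤ
    vx≡-1 = surj ≈-refl

    vx≤1 : v x ≤₋ 1ₘ
    vx≤1 = subst (_≤₋ 1ₘ) (sym vx≡-1) Inf.[ ℤ.-≤+ ]

    not-invertible : ¬ (∃[ y ] (x , vx≤1) B.* y B.≈ B.1#)
    not-invertible ((y , vy≤1) , xy≈1) with subst (_≤₋ 1ₘ) (v-inverse vx≡-1 xy≈1) vy≤1
    ... | Inf.[ ℤ.+≤+ () ]

  unitBall-isDiscreteValuationRing : IsDiscreteValuationRing (unitBall A V)
  unitBall-isDiscreteValuationRing = record
    { isPrincipalIdealDomain = record
      { isIntegralDomain = unitBall-isIntegralDomain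
      ; principal        = unitBall-principal }
    ; isLocal  = unitBall-isLocal
    ; notField = unitBall-notField }

-- Discreteness of the completion

-- `em` is implicit because, as an explicit argument, it would be η-expanded,
-- and checking the two forms of the completion equal would unfold both.
module _ {em : Classical} {c ℓ} {K : Field c ℓ} {V : Valuation (Field.commutativeRing K)}
         (surjective : ∀ α → ∃[ x ] Valuation.val V x ≡ α) where

  -- Constant sequences already attain every value. `Surjective` asks for the value on all sequences
  -- equivalent to the witness, whence `v-cong`.
  completion-isDiscrete : IsDiscrete (Field.commutativeRing (completion em K V)) (completedValuation em K V)
  completion-isDiscrete α with surjective α
  ... | x , vx≡α = constant x , λ {y} y≈x →
    trans (IsValuation.v-cong v̂-isValuation {y} {constant x} y≈x) (trans (v̂-constant x) vx≡α)
    where open Completion em K V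

  completion-unitBall-isDiscreteValuationRing :
    IsDiscreteValuationRing (unitBall (Field.commutativeRing (completion em K V)) (completedValuation em K V))
  completion-unitBall-isDiscreteValuationRing = DiscreteValuationField.unitBall-isDiscreteValuationRing
    em {A = Field.commutativeRing (completion em K V)} (Field.isField (completion em K V))
    (completedValuation em K V) completion-isDiscrete

-- The case of a nonzero prime ideal of a Dedekind domain

module _ (em : Classical) {c ℓ k ℓₖ} (R : CommutativeRing c ℓ) (F : FractionField R k ℓₖ)
         (dedekind : IsDedekindDomain R F) (𝔪 : Ideal R) (𝔪≉0 : IsNonzero R 𝔪) (𝔪-prime : IsPrime R 𝔪) where
  private
    𝔪-max : IsMaximal R 𝔪
    𝔪-max = IsDedekindDomain.prime⇒maximal dedekind 𝔪 𝔪≉0 𝔪-prime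

    inversion : Dedekind.Inversion em R F dedekind 𝔪
    inversion = Dedekind.invert em R F dedekind {𝔪} 𝔪-max 𝔪≉0

  adicValuation-isValuation : IsValuation (Field.commutativeRing (FractionField.K F)) (adicValuation em R F 𝔪)
  adicValuation-isValuation = AdicValuation.v-isValuation em R F dedekind {𝔪} 𝔪-max inversion

  adicValuation-surjective : ∀ α → ∃[ x ] adicValuation em R F 𝔪 x ≡ α
  adicValuation-surjective = AdicValuation.v-surjective em R F dedekind {𝔪} 𝔪-max inversion

mainTheorem4 :
    (em : Classical) →
    ∀ {c ℓ k ℓₖ} (R : CommutativeRing c ℓ) (F : FractionField R k ℓₖ) →
    IsDedekindDomain R F →
    (𝔪 : Ideal R) → IsNonzero R 𝔪 → IsPrime R 𝔪 →
    let K  = FractionField.K F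
        v𝔪 = adicValuation em R F 𝔪
    in
    Σ[ isVal ∈ IsValuation (Field.commutativeRing K) v𝔪 ]
      let V  = mkValuation v𝔪 isVal
          K̂  = Field.commutativeRing (completion em K V)
          v̂𝔪 = completedValuation em K V
      in IsDiscrete K̂ v̂𝔪 × IsDiscreteValuationRing (unitBall K̂ v̂𝔪)
mainTheorem4 em R F dedekind 𝔪 𝔪≉0 𝔪-prime =
  adicValuation-isValuation em R F dedekind 𝔪 𝔪≉0 𝔪-prime ,
  completion-isDiscrete surjective ,
  completion-unitBall-isDiscreteValuationRing surjective
  where
  surjective = adicValuation-surjective em R F dedekind 𝔪 𝔪≉0 𝔪-prime
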